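{- Let $m\ge 3$ and $\epsilon\in\{+1,-1\}$. Let $Q$ be a nondegenerate quadratic form on $V=\mathbb{F}_3^{2m}$ of type $\epsilon$ (hyperbolic if $\epsilon=+1$, elliptic if $\epsilon=-1$), with polar form $B(x,y)=Q(x+y)-Q(x)-Q(y)$. Let $\mathrm{NO}^\epsilon_{2m}(3)$ be the graph whose vertices are the $1$-dimensional subspaces $\langle x\rangle$ with $Q(x)=1$, two distinct vertices $\langle x\rangle,\langle y\rangle$ being adjacent if $B(x,y)=0$. Then $\mathrm{NO}^\epsilon_{2m}(3)$ is separating.
   Context: A graph $\Gamma$ is separating if $\omega(\Gamma)\alpha(\Gamma)<|V(\Gamma)|$, where $\omega$ and $\alpha$ are the maximum clique and coclique sizes. (This property is unchanged on passing to the complementary graph.) -}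

module Defs where

open import Data.Nat using (ℕ; zero; suc; _*_; _<_; _≤_; _∸_)
open import Data.Fin using (Fin; zero; suc)
open import Data.Vec using (Vec; []; _∷_; zipWith; map; replicate; lookup)
open import Data.List using (List; length)
open import Data.List.Relation.Unary.AllPairs using (AllPairs)
open import Data.List.Relation.Unary.Any using (Any)
open import Data.Product using (Σ; _×_)
open import Data.Sign using (Sign)
open import Relation.Binary.PropositionalEquality using (_≡_; _≢_)
open import Relation.Nullary using (¬_)

F₃ : Set
F₃ = Fin 3

pattern 𝟘 = zero
pattern 𝟙 = suc zero
pattern 𝟚 = suc (suc zero)

infixl 6 _⊕_ _⊖_
infixl 7 _⊗_

_⊕_ : F₃ → F₃ → F₃
𝟘 ⊕ y = y
𝟙 ⊕ 𝟘 = 𝟙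
𝟙 ⊕ 𝟙 = 𝟚
𝟙 ⊕ 𝟚 = 𝟘
𝟚 ⊕ 𝟘 = 𝟚
𝟚 ⊕ 𝟙 = 𝟘
𝟚 ⊕ 𝟚 = 𝟙

neg : F₃ → F₃
neg 𝟘 = 𝟘
neg 𝟙 = 𝟚
neg 𝟚 = 𝟙

_⊖_ : F₃ → F₃ → F₃
x ⊖ y = x ⊕ neg y

_⊗_ : F₃ → F₃ → F₃
𝟘 ⊗ y = 𝟘
𝟙 ⊗ y = y
𝟚 ⊗ y = neg y

∑ : (n : ℕ) → (Fin n → F₃) → F₃
∑ zero    f = 𝟘
∑ (suc n) f = f zero ⊕ ∑ n (λ i → f (suc i))

Vecₙ : ℕ → Set
Vecₙ n = Vec F₃ n

_+ᵥ_ : ∀ {n} → Vecₙ n → Vecₙ n → Vecₙ n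
_+ᵥ_ = zipWith _⊕_

_·ᵥ_ : ∀ {n} → F₃ → Vecₙ n → Vecₙ n
c ·ᵥ x = map (c ⊗_) x

0ᵥ : ∀ {n} → Vecₙ n
0ᵥ = replicate _ 𝟘

lincomb : ∀ {n} k → (Fin k → F₃) → (Fin k → Vecₙ n) → Vecₙ n
lincomb zero    c u = 0ᵥ
lincomb (suc k) c u = (c zero ·ᵥ u zero) +ᵥ lincomb k (λ i → c (suc i)) (λ i → u (suc i))

LinIndep : ∀ {n} k → (Fin k → Vecₙ n) → Set
LinIndep k u = ∀ (c : Fin k → F₃) → lincomb k c u ≡ 0ᵥ → ∀ i → c i ≡ 𝟘

QuadForm : ℕ → Set
QuadForm n = Fin n → Fin n → F₃

eval : ∀ {n} → QuadForm n → Vecₙ n → F₃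
eval {n} a x = ∑ n (λ i → ∑ n (λ j → a i j ⊗ lookup x i ⊗ lookup x j))

polar : ∀ {n} → QuadForm n → Vecₙ n → Vecₙ n → F₃
polar Q x y = eval Q (x +ᵥ y) ⊖ eval Q x ⊖ eval Q y

-- nondegenerate: the polar form has trivial radical (odd characteristic)
Nondegenerate : ∀ {n} → QuadForm n → Set
Nondegenerate {n} Q = ∀ (x : Vecₙ n) → (∀ y → polar Q x y ≡ 𝟘) → x ≡ 0ᵥ

HasTotSingSub : ∀ {n} → QuadForm n → ℕ → Set
HasTotSingSub {n} Q k =
  Σ (Fin k → Vecₙ n) λ u → LinIndep k u × (∀ c → eval Q (lincomb k c u) ≡ 𝟘)

-- type of a form on F₃^{2m} via its Witt index:
-- hyperbolic (+1): Witt index m;  elliptic (−1): Witt index m − 1.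
HasType : (m : ℕ) → Sign → QuadForm (2 * m) → Set
HasType m Sign.+ Q = HasTotSingSub Q m
HasType m Sign.- Q = HasTotSingSub Q (m ∸ 1) × ¬ HasTotSingSub Q m

record Graph : Set₁ where
  field
    V     : Set
    _≈_   : V → V → Set
    Adj   : V → V → Set

module _ (G : Graph) where
  open Graph G

  IsClique : List V → Set
  IsClique vs = AllPairs (λ u v → ¬ (u ≈ v) × Adj u v) vs

  IsCoclique : List V → Set
  IsCoclique vs = AllPairs (λ u v → ¬ (u ≈ v) × ¬ Adj u v) vs

  HasOrder : ℕ → Set
  HasOrder N = Σ (List V) λ vs → length vs ≡ N × AllPairs (λ u v → ¬ (u ≈ v)) vs
                 × (∀ v → Any (λ u → u ≈ v) vs)

  CliqueNumber : ℕ → Set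
  CliqueNumber w = (Σ (List V) λ vs → IsClique vs × length vs ≡ w)
                 × (∀ vs → IsClique vs → length vs ≤ w)

  CocliqueNumber : ℕ → Set
  CocliqueNumber a = (Σ (List V) λ vs → IsCoclique vs × length vs ≡ a)
                   × (∀ vs → IsCoclique vs → length vs ≤ a)

  Separating : Set
  Separating = Σ ℕ λ N → Σ ℕ λ w → Σ ℕ λ a →
    HasOrder N × CliqueNumber w × CocliqueNumber a × w * a < N

-- The graph NO^ε_{2m}(3): vertices are 1-dimensional subspaces ⟨x⟩ with
-- Q(x) = 1, represented by a spanning vector x; ⟨x⟩ = ⟨y⟩ iff y = c·x for
-- some nonzero scalar c; distinct ⟨x⟩,⟨y⟩ adjacent iff B(x,y) = 0.

SameLine : ∀ {n} → Vecₙ n → Vecₙ n → Set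
SameLine x y = Σ F₃ λ c → c ≢ 𝟘 × y ≡ c ·ᵥ x

NO : ∀ {n} → QuadForm n → Graph
NO {n} Q = record
  { V   = Σ (Vecₙ n) λ x → eval Q x ≡ 𝟙
  ; _≈_ = λ x y → SameLine (Data.Product.proj₁ x) (Data.Product.proj₁ y)
  ; Adj = λ x y → polar Q (Data.Product.proj₁ x) (Data.Product.proj₁ y) ≡ 𝟘
  }

{-# OPTIONS --safe #-}
module Submission where

-- Vertices are vectors x with Q x = 1, hence B x x = 2.  A clique is an orthogonal
-- set of such vectors, so it has at most 2m members.  In a coclique fix a vertex x₀
-- and choose signs such that B x₀ y = 2 for all members y; then the vectors
-- z = y - x₀ are singular, orthogonal to x₀, and B takes only the values 0 and 2 on
-- them.  Let n be the rank of their Gram matrix and k the dimension of the radical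
-- of their span.  Then n + 2k + 1 ≤ 2m, and z is determined by its products with n
-- of the vectors and k coordinates in the radical, so the coclique has at most
-- 2^n 3^k ≤ 2^(2m-1) members.  Since the number of vertices is 3^(m-1) (3^m - ε) / 2,
-- this suffices for m ≥ 4.  For m = 3 the bound is needed in the sharper form 19,
-- where singularity of z cuts down the possible product vectors for (n , k) = (3 , 1)
-- and (5 , 0); these are checked by computation over all Gram matrices.

open import Defs
open import Algebra.Bundles using (CommutativeRing)
import Algebra.Solver.Ring.Simple as RingSolver
open import Algebra.Solver.Ring.AlmostCommutativeRing using (fromCommutativeRing)
open import Axiom.UniquenessOfIdentityProofs.WithK using (uip)
open import Data.Empty using (⊥)
open import Data.Fin using (Fin; zero; suc)
open import Data.Fin.Properties using (_≟_; all?; any?)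
open import Data.List using (List; []; _∷_; length; filter; cartesianProduct; cartesianProductWith)
import Data.List as List
open import Data.List.Membership.Propositional using (_∈_; lose; find)
open import Data.List.Membership.Propositional.Properties
  using (∈-∃++; ∈-++⁺ˡ; ∈-++⁺ʳ; ∈-++⁻; ∈-map⁺; ∈-map⁻; ∈-filter⁺; ∈-filter⁻;
         ∈-cartesianProductWith⁺; ∈-cartesianProduct⁺; ∈-cartesianProduct⁻)
open import Data.List.Properties using (length-++; length-map)
open import Data.List.Relation.Unary.All using (All; []; _∷_)
import Data.List.Relation.Unary.All as All
import Data.List.Relation.Unary.All.Properties as All
open import Data.List.Relation.Unary.AllPairs using (AllPairs; []; _∷_)
import Data.List.Relation.Unary.AllPairs as AllPairs
import Data.List.Relation.Unary.AllPairs.Properties as AllPairs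
open import Data.List.Relation.Unary.Any using (Any; here; there)
import Data.List.Relation.Unary.Any as Any
import Data.List.Relation.Unary.Any.Properties as Any
open import Data.List.Relation.Unary.Unique.Propositional using (Unique)
import Data.List.Relation.Unary.Unique.Propositional.Properties as Unique
open import Data.Nat using (ℕ; zero; suc; _+_; _*_; _^_; _≤_; _<_; z≤n; s≤s)
import Data.Nat.Properties as ℕ
open import Data.Nat.Tactic.RingSolver using (solve-∀)
open import Data.Product using (Σ; ∃; _×_; _,_; proj₁; proj₂; uncurry)
open import Data.Sign using (Sign)
open import Data.Sum using (_⊎_; inj₁; inj₂; [_,_]′)
open import Data.Unit using (⊤; tt)
open import Data.Vec using (Vec; []; _∷_; _++_; fromList; lookup; map; replicate; splitAt; tabulate)
import Data.Vec.Properties as Vec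
open import Data.Vec.Relation.Unary.All using ([]; _∷_)
import Data.Vec.Relation.Unary.All as VAll
import Data.Vec.Relation.Unary.All.Properties as VAll
open import Function using (_∘_; id)
open import Relation.Binary.PropositionalEquality
open import Relation.Nullary using (¬_; Dec; yes; no; contradiction)
open import Relation.Nullary.Decidable
  using (True; toWitness; decidable-stable; map′; _×-dec_; _⊎-dec_; _→-dec_; ¬?)

-- The inequality n + 2k + 1 ≤ 2m comes from nondegeneracy: the k radical vectors are orthogonal to
-- the whole span, so they need k partners outside it, and x₀ adds one more dimension. Each radical
-- dimension thus costs two dimensions and contributes only a factor 3 < 2². The constant 19 is
-- dictated by the hyperbolic graph for m = 3: it has 117 vertices, the clique bound is 6, and 6 ·
-- 19 = 114 < 117 < 6 · 20. Plain counting exceeds 19 only for (n , k) = (5 , 0), where it gives 32,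
-- and (3 , 1), where it gives 24. The type ε matters only for the number of vertices, of which just
-- a lower bound is proved: vectors with Q = 1 are listed in coordinates adapted to a totally
-- singular subspace and a family dual to it. Ranks and dimensions are not defined as such. Each is
-- the size of a maximal pair of dual families, found by finite search, and inequalities between
-- them follow by comparing powers of 3 or 2.

-- Arithmetic of F₃, by exhaustion.

by-cases : ∀ {a} {A : Set a} (a? : Dec A) {_ : True a?} → A
by-cases _ {t} = toWitness t

⊕-assoc : ∀ a b c → (a ⊕ b) ⊕ c ≡ a ⊕ (b ⊕ c)
⊕-assoc = by-cases (all? λ a → all? λ b → all? λ c → _ ≟ _)

⊕-comm : ∀ a b → a ⊕ b ≡ b ⊕ a
⊕-comm = by-cases (all? λ a → all? λ b → _ ≟ _)

⊕-identityʳ : ∀ a → a ⊕ 𝟘 ≡ a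
⊕-identityʳ = by-cases (all? λ a → _ ≟ _)

⊕-inverseˡ : ∀ a → neg a ⊕ a ≡ 𝟘
⊕-inverseˡ = by-cases (all? λ a → _ ≟ _)

⊕-inverseʳ : ∀ a → a ⊕ neg a ≡ 𝟘
⊕-inverseʳ = by-cases (all? λ a → _ ≟ _)

⊗-assoc : ∀ a b c → (a ⊗ b) ⊗ c ≡ a ⊗ (b ⊗ c)
⊗-assoc = by-cases (all? λ a → all? λ b → all? λ c → _ ≟ _)

⊗-comm : ∀ a b → a ⊗ b ≡ b ⊗ a
⊗-comm = by-cases (all? λ a → all? λ b → _ ≟ _)

⊗-identityʳ : ∀ a → a ⊗ 𝟙 ≡ a
⊗-identityʳ = by-cases (all? λ a → _ ≟ _)

⊗-zeroʳ : ∀ a → a ⊗ 𝟘 ≡ 𝟘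
⊗-zeroʳ = by-cases (all? λ a → _ ≟ _)

⊗-distribˡ-⊕ : ∀ a b c → a ⊗ (b ⊕ c) ≡ a ⊗ b ⊕ a ⊗ c
⊗-distribˡ-⊕ = by-cases (all? λ a → all? λ b → all? λ c → _ ≟ _)

⊗-distribʳ-⊕ : ∀ a b c → (b ⊕ c) ⊗ a ≡ b ⊗ a ⊕ c ⊗ a
⊗-distribʳ-⊕ = by-cases (all? λ a → all? λ b → all? λ c → _ ≟ _)

F₃-commutativeRing : CommutativeRing _ _
F₃-commutativeRing = record
  { Carrier = F₃ ; _≈_ = _≡_ ; _+_ = _⊕_ ; _*_ = _⊗_ ; -_ = neg ; 0# = 𝟘 ; 1# = 𝟙
  ; isCommutativeRing = record
    { isRing = record
      { +-isAbelianGroup = record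
        { isGroup = record
          { isMonoid = record
            { isSemigroup = record
              { isMagma = record { isEquivalence = isEquivalence ; ∙-cong = cong₂ _⊕_ }
              ; assoc = ⊕-assoc }
            ; identity = (λ _ → refl) , ⊕-identityʳ }
          ; inverse = ⊕-inverseˡ , ⊕-inverseʳ
          ; ⁻¹-cong = cong neg }
        ; comm = ⊕-comm }
      ; *-cong = cong₂ _⊗_
      ; *-assoc = ⊗-assoc
      ; *-identity = (λ _ → refl) , ⊗-identityʳ
      ; distrib = ⊗-distribˡ-⊕ , ⊗-distribʳ-⊕ }
    ; *-comm = ⊗-comm } }

open RingSolver (fromCommutativeRing F₃-commutativeRing) _≟_
  using (solve; _:+_; _:*_; _:-_; :-_; _:=_; con)

neg≡0⇒≡0 : ∀ a → neg a ≡ 𝟘 → a ≡ 𝟘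
neg≡0⇒≡0 = by-cases (all? λ a → (_ ≟ _) →-dec (_ ≟ _))

x⊖y≡0⇒x≡y : ∀ a b → a ⊖ b ≡ 𝟘 → a ≡ b
x⊖y≡0⇒x≡y = by-cases (all? λ a → all? λ b → (_ ≟ _) →-dec (_ ≟ _))

≢0⇒square≡1 : ∀ a → a ≢ 𝟘 → a ⊗ a ≡ 𝟙
≢0⇒square≡1 𝟘 a≢0 = contradiction refl a≢0
≢0⇒square≡1 𝟙 _ = refl
≢0⇒square≡1 𝟚 _ = refl

-- Counting with duplicate-free lists.

module _ {a b} {A : Set a} {B : Set b} (f : A → B) where

  -- Pigeonhole, by cutting `f x` out of `L`. Injectivity is relative to `xs` because the codes of
  -- vectors used below separate only the members of one coclique.
  injectiveOn⇒length≤ : ∀ {xs L} → Unique xs → (∀ {x y} → x ∈ xs → y ∈ xs → f x ≡ f y → x ≡ y) →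
                        (∀ {x} → x ∈ xs → f x ∈ L) → length xs ≤ length L
  injectiveOn⇒length≤ [] _ _ = z≤n
  injectiveOn⇒length≤ {x ∷ xs} (x∉xs ∷ unique) injective f∈L with ∈-∃++ (f∈L (here refl))
  ... | as , bs , refl = begin
    suc (length xs)                    ≤⟨ s≤s (injectiveOn⇒length≤ unique (λ y∈ z∈ → injective (there y∈) (there z∈)) skip) ⟩
    suc (length (as List.++ bs))       ≡⟨ cong suc (length-++ as) ⟩
    suc (length as + length bs)        ≡⟨ ℕ.+-suc (length as) (length bs) ⟨
    length as + suc (length bs)        ≡⟨ length-++ as ⟨
    length (as List.++ f x ∷ bs)       ∎
    where
    open ℕ.≤-Reasoning
    skip : ∀ {y} → y ∈ xs → f y ∈ as List.++ bs
    skip y∈xs with ∈-++⁻ as (f∈L (there y∈xs))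
    ... | inj₁ fy∈as = ∈-++⁺ˡ fy∈as
    ... | inj₂ (here fy≡fx) = contradiction (injective (here refl) (there y∈xs) (sym fy≡fx)) (All.lookup x∉xs y∈xs)
    ... | inj₂ (there fy∈bs) = ∈-++⁺ʳ as fy∈bs

  map-unique : ∀ {xs} → Unique xs → (∀ {x y} → x ∈ xs → y ∈ xs → f x ≡ f y → x ≡ y) → Unique (List.map f xs)
  map-unique []              _         = []
  map-unique (x∉xs ∷ unique) injective =
    All.map⁺ (All.tabulate λ y∈xs e → All.lookup x∉xs y∈xs (injective (here refl) (there y∈xs) e))
    ∷ map-unique unique (λ y∈ z∈ → injective (there y∈) (there z∈))

length-cartesianProductWith : ∀ {a b c} {A : Set a} {B : Set b} {C : Set c} (f : A → B → C) xs ys →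
                              length (cartesianProductWith f xs ys) ≡ length xs * length ys
length-cartesianProductWith f []       ys = refl
length-cartesianProductWith f (x ∷ xs) ys = trans (length-++ (List.map (f x) ys))
  (cong₂ _+_ (length-map (f x) ys) (length-cartesianProductWith f xs ys))

-- Enumeration of F₃ⁿ.

scalars : List F₃
scalars = 𝟘 ∷ 𝟙 ∷ 𝟚 ∷ []

vectors : ∀ n → List (Vecₙ n)
vectors zero    = [] ∷ []
vectors (suc n) = cartesianProductWith _∷_ scalars (vectors n)

∈-scalars : ∀ a → a ∈ scalars
∈-scalars 𝟘 = here refl
∈-scalars 𝟙 = there (here refl)
∈-scalars 𝟚 = there (there (here refl))

∈-vectors : ∀ {n} (x : Vecₙ n) → x ∈ vectors n
∈-vectors []      = here refl
∈-vectors (a ∷ x) = ∈-cartesianProductWith⁺ _∷_ (∈-scalars a) (∈-vectors x)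

vectors-unique : ∀ n → Unique (vectors n)
vectors-unique zero    = [] ∷ []
vectors-unique (suc n) =
  Unique.cartesianProductWith⁺ _∷_ Vec.∷-injective
    (((λ ()) ∷ (λ ()) ∷ []) ∷ ((λ ()) ∷ []) ∷ [] ∷ []) (vectors-unique n)

length-vectors : ∀ n → length (vectors n) ≡ 3 ^ n
length-vectors zero    = refl
length-vectors (suc n) = trans (length-cartesianProductWith _∷_ scalars (vectors n))
                               (cong (3 *_) (length-vectors n))

_≟ᵥ_ : ∀ {n} (x y : Vecₙ n) → Dec (x ≡ y)
_≟ᵥ_ = Vec.≡-dec _≟_

anyVector? : ∀ {n p} {P : Vecₙ n → Set p} → (∀ x → Dec (P x)) → Dec (∃ P)
anyVector? {n} P? = map′ Any.satisfied (λ (x , px) → lose (∈-vectors x) px) (Any.any? P? (vectors n))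

allVectors? : ∀ {n p} {P : Vecₙ n → Set p} → (∀ x → Dec (P x)) → Dec (∀ x → P x)
allVectors? {n} P? = map′ (λ ps x → All.lookup ps (∈-vectors x)) (λ ps → All.tabulate (λ {x} _ → ps x))
                          (All.all? P? (vectors n))

-- Counting 3^k ≤ 3^n stands in for dimension theory; every dimension inequality below rests on
-- this.
injective⇒dim≤ : ∀ {k n} (f : Vecₙ k → Vecₙ n) → (∀ {x y} → f x ≡ f y → x ≡ y) → k ≤ n
injective⇒dim≤ {k} {n} f f-injective = ℕ.≮⇒≥ λ n<k → ℕ.<⇒≱ (ℕ.^-monoʳ-< 3 (s≤s (s≤s z≤n)) n<k) (begin
  3 ^ k               ≡⟨ length-vectors k ⟨
  length (vectors k)  ≤⟨ injectiveOn⇒length≤ f (vectors-unique k) (λ _ _ → f-injective) (λ {x} _ → ∈-vectors (f x)) ⟩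
  length (vectors n)  ≡⟨ length-vectors n ⟩
  3 ^ n               ∎)
  where open ℕ.≤-Reasoning

-- Vector arithmetic and the dot product.

infix 9 _∙_

_∙_ : ∀ {n} → Vecₙ n → Vecₙ n → F₃
[]      ∙ []      = 𝟘
(a ∷ x) ∙ (b ∷ y) = a ⊗ b ⊕ x ∙ y

infixl 6 _-ᵥ_

_-ᵥ_ : ∀ {n} → Vecₙ n → Vecₙ n → Vecₙ n
x -ᵥ y = x +ᵥ (𝟚 ·ᵥ y)

+ᵥ-comm : ∀ {n} (x y : Vecₙ n) → x +ᵥ y ≡ y +ᵥ x
+ᵥ-comm [] [] = refl
+ᵥ-comm (a ∷ x) (b ∷ y) = cong₂ _∷_ (⊕-comm a b) (+ᵥ-comm x y)

+ᵥ-assoc : ∀ {n} (x y z : Vecₙ n) → (x +ᵥ (y +ᵥ z)) ≡ ((x +ᵥ y) +ᵥ z)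
+ᵥ-assoc [] [] [] = refl
+ᵥ-assoc (a ∷ x) (b ∷ y) (c ∷ z) = cong₂ _∷_ (sym (⊕-assoc a b c)) (+ᵥ-assoc x y z)

+ᵥ-identityˡ : ∀ {n} (x : Vecₙ n) → 0ᵥ +ᵥ x ≡ x
+ᵥ-identityˡ [] = refl
+ᵥ-identityˡ (a ∷ x) = cong (a ∷_) (+ᵥ-identityˡ x)

+ᵥ-identityʳ : ∀ {n} (x : Vecₙ n) → x +ᵥ 0ᵥ ≡ x
+ᵥ-identityʳ x = trans (+ᵥ-comm x 0ᵥ) (+ᵥ-identityˡ x)

+ᵥ-interchange : ∀ {n} (w x y z : Vecₙ n) → ((w +ᵥ x) +ᵥ (y +ᵥ z)) ≡ ((w +ᵥ y) +ᵥ (x +ᵥ z))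
+ᵥ-interchange [] [] [] [] = refl
+ᵥ-interchange (a ∷ w) (b ∷ x) (c ∷ y) (d ∷ z) = cong₂ _∷_
  (solve 4 (λ a b c d → (a :+ b) :+ (c :+ d) := (a :+ c) :+ (b :+ d)) refl a b c d)
  (+ᵥ-interchange w x y z)

+ᵥ-cancelˡ : ∀ {n} (x : Vecₙ n) {y z} → x +ᵥ y ≡ x +ᵥ z → y ≡ z
+ᵥ-cancelˡ [] {[]} {[]} _ = refl
+ᵥ-cancelˡ (a ∷ x) {b ∷ y} {c ∷ z} e = cong₂ _∷_
  (cancel a b c (Vec.∷-injectiveˡ e)) (+ᵥ-cancelˡ x (Vec.∷-injectiveʳ e))
  where
  cancel : ∀ a b c → a ⊕ b ≡ a ⊕ c → b ≡ c
  cancel = by-cases (all? λ a → all? λ b → all? λ c → (_ ≟ _) →-dec (_ ≟ _))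

-ᵥ-self : ∀ {n} (x : Vecₙ n) → x -ᵥ x ≡ 0ᵥ
-ᵥ-self [] = refl
-ᵥ-self (a ∷ x) = cong₂ _∷_ (⊕-inverseʳ a) (-ᵥ-self x)

x-y≡0⇒x≡y : ∀ {n} (x y : Vecₙ n) → x -ᵥ y ≡ 0ᵥ → x ≡ y
x-y≡0⇒x≡y [] [] _ = refl
x-y≡0⇒x≡y (a ∷ x) (b ∷ y) e = cong₂ _∷_
  (x⊖y≡0⇒x≡y a b (Vec.∷-injectiveˡ e)) (x-y≡0⇒x≡y x y (Vec.∷-injectiveʳ e))

·ᵥ-zeroˡ : ∀ {n} (x : Vecₙ n) → 𝟘 ·ᵥ x ≡ 0ᵥ
·ᵥ-zeroˡ [] = refl
·ᵥ-zeroˡ (a ∷ x) = cong (𝟘 ∷_) (·ᵥ-zeroˡ x)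

·ᵥ-zeroʳ : ∀ {n} c → c ·ᵥ 0ᵥ {n} ≡ 0ᵥ
·ᵥ-zeroʳ {zero} c = refl
·ᵥ-zeroʳ {suc n} c = cong₂ _∷_ (⊗-zeroʳ c) (·ᵥ-zeroʳ c)

·ᵥ-identityˡ : ∀ {n} (x : Vecₙ n) → 𝟙 ·ᵥ x ≡ x
·ᵥ-identityˡ = Vec.map-id

·ᵥ-assoc : ∀ {n} c d (x : Vecₙ n) → (c ⊗ d) ·ᵥ x ≡ c ·ᵥ (d ·ᵥ x)
·ᵥ-assoc c d [] = refl
·ᵥ-assoc c d (a ∷ x) = cong₂ _∷_ (⊗-assoc c d a) (·ᵥ-assoc c d x)

·ᵥ-distribˡ : ∀ {n} c (x y : Vecₙ n) → c ·ᵥ (x +ᵥ y) ≡ (c ·ᵥ x) +ᵥ (c ·ᵥ y)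
·ᵥ-distribˡ c [] [] = refl
·ᵥ-distribˡ c (a ∷ x) (b ∷ y) = cong₂ _∷_ (⊗-distribˡ-⊕ c a b) (·ᵥ-distribˡ c x y)

·ᵥ-distribʳ : ∀ {n} c d (x : Vecₙ n) → (c ⊕ d) ·ᵥ x ≡ (c ·ᵥ x) +ᵥ (d ·ᵥ x)
·ᵥ-distribʳ c d [] = refl
·ᵥ-distribʳ c d (a ∷ x) = cong₂ _∷_ (⊗-distribʳ-⊕ a c d) (·ᵥ-distribʳ c d x)

x+[y-x]≡y : ∀ {n} (x y : Vecₙ n) → x +ᵥ (y -ᵥ x) ≡ y
x+[y-x]≡y [] [] = refl
x+[y-x]≡y (a ∷ x) (b ∷ y) = cong₂ _∷_
  (solve 2 (λ a b → a :+ (b :+ (:- a)) := b) refl a b) (x+[y-x]≡y x y)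

x-0≡x : ∀ {n} (x : Vecₙ n) → x -ᵥ 0ᵥ ≡ x
x-0≡x x = trans (cong (x +ᵥ_) (·ᵥ-zeroʳ 𝟚)) (+ᵥ-identityʳ x)

∙-comm : ∀ {n} (x y : Vecₙ n) → x ∙ y ≡ y ∙ x
∙-comm [] [] = refl
∙-comm (a ∷ x) (b ∷ y) = cong₂ _⊕_ (⊗-comm a b) (∙-comm x y)

∙-zeroˡ : ∀ {n} (x : Vecₙ n) → 0ᵥ ∙ x ≡ 𝟘
∙-zeroˡ [] = refl
∙-zeroˡ (a ∷ x) = ∙-zeroˡ x

∙-zeroʳ : ∀ {n} (x : Vecₙ n) → x ∙ 0ᵥ ≡ 𝟘
∙-zeroʳ x = trans (∙-comm x 0ᵥ) (∙-zeroˡ x)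

∙-nondegenerate : ∀ {n} (x y : Vecₙ n) → (∀ d → d ∙ x ≡ d ∙ y) → x ≡ y
∙-nondegenerate [] [] _ = refl
∙-nondegenerate (a ∷ x) (b ∷ y) e = cong₂ _∷_ (begin
    a               ≡⟨ ⊕-identityʳ a ⟨
    a ⊕ 𝟘           ≡⟨ cong (a ⊕_) (∙-zeroˡ x) ⟨
    a ⊕ 0ᵥ ∙ x      ≡⟨ e (𝟙 ∷ 0ᵥ) ⟩
    b ⊕ 0ᵥ ∙ y      ≡⟨ cong (b ⊕_) (∙-zeroˡ y) ⟩
    b ⊕ 𝟘           ≡⟨ ⊕-identityʳ b ⟩
    b               ∎)
  (∙-nondegenerate x y λ d → e (𝟘 ∷ d))
  where open ≡-Reasoning

-- Linear combinations, independence, subspaces.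

comb : ∀ {N k} → Vecₙ k → Vec (Vecₙ N) k → Vecₙ N
comb []      []      = 0ᵥ
comb (a ∷ c) (x ∷ X) = (a ·ᵥ x) +ᵥ comb c X

comb-+ : ∀ {N k} (c d : Vecₙ k) (X : Vec (Vecₙ N) k) → comb (c +ᵥ d) X ≡ comb c X +ᵥ comb d X
comb-+ [] [] [] = sym (+ᵥ-identityˡ _)
comb-+ (a ∷ c) (b ∷ d) (x ∷ X) = trans (cong₂ _+ᵥ_ (·ᵥ-distribʳ a b x) (comb-+ c d X)) (+ᵥ-interchange _ _ _ _)

comb-· : ∀ {N k} a (c : Vecₙ k) (X : Vec (Vecₙ N) k) → comb (a ·ᵥ c) X ≡ a ·ᵥ comb c X
comb-· a [] [] = sym (·ᵥ-zeroʳ a)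
comb-· a (b ∷ c) (x ∷ X) = trans (cong₂ _+ᵥ_ (·ᵥ-assoc a b x) (comb-· a c X)) (sym (·ᵥ-distribˡ a _ _))

comb-- : ∀ {N k} (c d : Vecₙ k) (X : Vec (Vecₙ N) k) → comb (c -ᵥ d) X ≡ comb c X -ᵥ comb d X
comb-- c d X = trans (comb-+ c _ X) (cong (comb c X +ᵥ_) (comb-· 𝟚 d X))

comb-++ : ∀ {N k l} (c : Vecₙ k) (d : Vecₙ l) (X : Vec (Vecₙ N) k) (Y : Vec (Vecₙ N) l) →
          comb (c ++ d) (X ++ Y) ≡ comb c X +ᵥ comb d Y
comb-++ [] d [] Y = sym (+ᵥ-identityˡ _)
comb-++ (a ∷ c) d (x ∷ X) Y = trans (cong ((a ·ᵥ x) +ᵥ_) (comb-++ c d X Y)) (+ᵥ-assoc _ _ _)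

comb-zero : ∀ {N k} (X : Vec (Vecₙ N) k) → comb 0ᵥ X ≡ 0ᵥ
comb-zero [] = refl
comb-zero (x ∷ X) = trans (cong₂ _+ᵥ_ (·ᵥ-zeroˡ x) (comb-zero X)) (+ᵥ-identityˡ 0ᵥ)

comb-All : ∀ {N k} {P : Vecₙ N → Set} {X : Vec (Vecₙ N) k} → (∀ c → P (comb c X)) → VAll.All P X
comb-All {X = []} _ = []
comb-All {P = P} {x ∷ X} p =
  subst P (trans (cong₂ _+ᵥ_ (·ᵥ-identityˡ x) (comb-zero X)) (+ᵥ-identityʳ x)) (p (𝟙 ∷ 0ᵥ))
  ∷ comb-All λ c → subst P (trans (cong (_+ᵥ comb c X) (·ᵥ-zeroˡ x)) (+ᵥ-identityˡ _)) (p (𝟘 ∷ c))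

Independent : ∀ {N k} → Vec (Vecₙ N) k → Set
Independent X = ∀ c → comb c X ≡ 0ᵥ → c ≡ 0ᵥ

Independent⇒injective : ∀ {N k} {X : Vec (Vecₙ N) k} → Independent X → ∀ {c d} → comb c X ≡ comb d X → c ≡ d
Independent⇒injective {X = X} indep {c} {d} e = x-y≡0⇒x≡y c d (indep (c -ᵥ d) (begin
  comb (c -ᵥ d) X                 ≡⟨ comb-- c d X ⟩
  comb c X -ᵥ comb d X            ≡⟨ cong (_-ᵥ comb d X) e ⟩
  comb d X -ᵥ comb d X            ≡⟨ -ᵥ-self (comb d X) ⟩
  0ᵥ                              ∎))
  where open ≡-Reasoning

Independent⇒≤ : ∀ {N k} {X : Vec (Vecₙ N) k} → Independent X → k ≤ N
Independent⇒≤ {X = X} indep = injective⇒dim≤ (λ c → comb c X) (Independent⇒injective indep)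

record Subspace {N} (T : Vecₙ N → Set) : Set where
  field
    0∈ : T 0ᵥ
    +∈ : ∀ {x y} → T x → T y → T (x +ᵥ y)
    ·∈ : ∀ c {x} → T x → T (c ·ᵥ x)

  comb∈ : ∀ {k} (c : Vecₙ k) {X : Vec (Vecₙ N) k} → VAll.All T X → T (comb c X)
  comb∈ [] [] = 0∈
  comb∈ (a ∷ c) (tx ∷ tX) = +∈ (·∈ a tx) (comb∈ c tX)

  -∈ : ∀ {x y} → T x → T y → T (x -ᵥ y)
  -∈ tx ty = +∈ tx (·∈ 𝟚 ty)

-- Bilinearity of the polar form, and abstract quadratic spaces.

∑-cong : ∀ n {f g : Fin n → F₃} → (∀ i → f i ≡ g i) → ∑ n f ≡ ∑ n g
∑-cong zero    _   = refl
∑-cong (suc n) f≗g = cong₂ _⊕_ (f≗g zero) (∑-cong n (f≗g ∘ suc))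

∑-⊕ : ∀ n (f g : Fin n → F₃) → ∑ n (λ i → f i ⊕ g i) ≡ ∑ n f ⊕ ∑ n g
∑-⊕ zero    f g = refl
∑-⊕ (suc n) f g = trans (cong (f zero ⊕ g zero ⊕_) (∑-⊕ n (f ∘ suc) (g ∘ suc)))
  (solve 4 (λ a b c d → (a :+ b) :+ (c :+ d) := (a :+ c) :+ (b :+ d)) refl (f zero) (g zero) _ _)

∑-⊗ : ∀ n c (f : Fin n → F₃) → ∑ n (λ i → c ⊗ f i) ≡ c ⊗ ∑ n f
∑-⊗ zero    c f = sym (⊗-zeroʳ c)
∑-⊗ (suc n) c f = trans (cong (c ⊗ f zero ⊕_) (∑-⊗ n c (f ∘ suc))) (sym (⊗-distribˡ-⊕ c _ _))

module _ {n} (a : QuadForm n) where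

  bilinear : Vecₙ n → Vecₙ n → F₃
  bilinear x y = ∑ n (λ i → ∑ n (λ j → a i j ⊗ lookup x i ⊗ lookup y j))

  bilinear-+ˡ : ∀ x y z → bilinear (x +ᵥ y) z ≡ bilinear x z ⊕ bilinear y z
  bilinear-+ˡ x y z = trans
    (∑-cong n λ i → trans
      (∑-cong n λ j → trans
        (cong (λ t → a i j ⊗ t ⊗ lookup z j) (Vec.lookup-zipWith _⊕_ i x y))
        (solve 4 (λ a x y z → (a :* (x :+ y)) :* z := (a :* x) :* z :+ (a :* y) :* z) refl (a i j) (lookup x i) _ _))
      (∑-⊕ n _ _))
    (∑-⊕ n _ _)

  bilinear-+ʳ : ∀ x y z → bilinear x (y +ᵥ z) ≡ bilinear x y ⊕ bilinear x z
  bilinear-+ʳ x y z = trans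
    (∑-cong n λ i → trans
      (∑-cong n λ j → trans
        (cong (a i j ⊗ lookup x i ⊗_) (Vec.lookup-zipWith _⊕_ j y z))
        (⊗-distribˡ-⊕ (a i j ⊗ lookup x i) _ _))
      (∑-⊕ n _ _))
    (∑-⊕ n _ _)

  bilinear-·ˡ : ∀ c x y → bilinear (c ·ᵥ x) y ≡ c ⊗ bilinear x y
  bilinear-·ˡ c x y = trans
    (∑-cong n λ i → trans
      (∑-cong n λ j → trans
        (cong (λ t → a i j ⊗ t ⊗ lookup y j) (Vec.lookup-map i (c ⊗_) x))
        (solve 4 (λ a c x y → (a :* (c :* x)) :* y := c :* ((a :* x) :* y)) refl (a i j) c (lookup x i) _))
      (∑-⊗ n c _))
    (∑-⊗ n c _)

  bilinear-·ʳ : ∀ c x y → bilinear x (c ·ᵥ y) ≡ c ⊗ bilinear x y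
  bilinear-·ʳ c x y = trans
    (∑-cong n λ i → trans
      (∑-cong n λ j → trans
        (cong (a i j ⊗ lookup x i ⊗_) (Vec.lookup-map j (c ⊗_) y))
        (solve 3 (λ a c y → a :* (c :* y) := c :* (a :* y)) refl (a i j ⊗ lookup x i) c _))
      (∑-⊗ n c _))
    (∑-⊗ n c _)

  polar-bilinear : ∀ x y → polar a x y ≡ bilinear x y ⊕ bilinear y x
  polar-bilinear x y = begin
    bilinear (x +ᵥ y) (x +ᵥ y) ⊖ bilinear x x ⊖ bilinear y y
      ≡⟨ cong (λ t → t ⊖ bilinear x x ⊖ bilinear y y)
           (trans (bilinear-+ˡ x y (x +ᵥ y)) (cong₂ _⊕_ (bilinear-+ʳ x x y) (bilinear-+ʳ y x y))) ⟩
    bilinear x x ⊕ bilinear x y ⊕ (bilinear y x ⊕ bilinear y y) ⊖ bilinear x x ⊖ bilinear y y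
      ≡⟨ solve 4 (λ p q r s → (((p :+ q) :+ (r :+ s)) :+ (:- p)) :+ (:- s) := q :+ r) refl
           (bilinear x x) (bilinear x y) (bilinear y x) (bilinear y y) ⟩
    bilinear x y ⊕ bilinear y x ∎
    where open ≡-Reasoning

-- An interface to eval and polar that keeps them from unfolding.
record QuadraticSpace (N : ℕ) : Set where
  field
    q       : Vecₙ N → F₃
    B       : Vecₙ N → Vecₙ N → F₃
    B-+ˡ    : ∀ x y z → B (x +ᵥ y) z ≡ B x z ⊕ B y z
    B-·ˡ    : ∀ c x y → B (c ·ᵥ x) y ≡ c ⊗ B x y
    B-sym   : ∀ x y → B x y ≡ B y x
    q-+     : ∀ x y → q (x +ᵥ y) ≡ q x ⊕ q y ⊕ B x y
    q-·     : ∀ c x → q (c ·ᵥ x) ≡ c ⊗ c ⊗ q x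
    nondegenerate : ∀ x → (∀ y → B x y ≡ 𝟘) → x ≡ 0ᵥ

quadraticSpace : ∀ {N} (Q : QuadForm N) → Nondegenerate Q → QuadraticSpace N
quadraticSpace {N} Q nondeg = record
  { q = eval Q
  ; B = polar Q
  ; B-+ˡ = λ x y z → begin
      polar Q (x +ᵥ y) z
        ≡⟨ trans (polar-bilinear Q (x +ᵥ y) z) (cong₂ _⊕_ (bilinear-+ˡ Q x y z) (bilinear-+ʳ Q z x y)) ⟩
      (bilinear Q x z ⊕ bilinear Q y z) ⊕ (bilinear Q z x ⊕ bilinear Q z y)
        ≡⟨ solve 4 (λ a b c d → (a :+ b) :+ (c :+ d) := (a :+ c) :+ (b :+ d)) refl
             (bilinear Q x z) (bilinear Q y z) _ _ ⟩
      (bilinear Q x z ⊕ bilinear Q z x) ⊕ (bilinear Q y z ⊕ bilinear Q z y)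
        ≡⟨ cong₂ _⊕_ (polar-bilinear Q x z) (polar-bilinear Q y z) ⟨
      polar Q x z ⊕ polar Q y z ∎
  ; B-·ˡ = λ c x y → begin
      polar Q (c ·ᵥ x) y
        ≡⟨ trans (polar-bilinear Q (c ·ᵥ x) y) (cong₂ _⊕_ (bilinear-·ˡ Q c x y) (bilinear-·ʳ Q c y x)) ⟩
      c ⊗ bilinear Q x y ⊕ c ⊗ bilinear Q y x
        ≡⟨ ⊗-distribˡ-⊕ c _ _ ⟨
      c ⊗ (bilinear Q x y ⊕ bilinear Q y x)
        ≡⟨ cong (c ⊗_) (polar-bilinear Q x y) ⟨
      c ⊗ polar Q x y ∎
  ; B-sym = λ x y → trans (polar-bilinear Q x y) (trans (⊕-comm (bilinear Q x y) _) (sym (polar-bilinear Q y x)))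
  ; q-+ = λ x y → solve 3 (λ s a b → s := (a :+ b) :+ ((s :+ (:- a)) :+ (:- b))) refl
      (eval Q (x +ᵥ y)) (eval Q x) (eval Q y)
  ; q-· = λ c x → trans (bilinear-·ˡ Q c x (c ·ᵥ x))
      (trans (cong (c ⊗_) (bilinear-·ʳ Q c x x)) (sym (⊗-assoc c c _)))
  ; nondegenerate = nondeg }
  where open ≡-Reasoning

-- Dual families and the projections they define.

module Space {N} (S : QuadraticSpace N) where

  open QuadraticSpace S public

  B-+ʳ : ∀ x y z → B x (y +ᵥ z) ≡ B x y ⊕ B x z
  B-+ʳ x y z = trans (B-sym x _) (trans (B-+ˡ y z x) (cong₂ _⊕_ (B-sym y x) (B-sym z x)))

  B-·ʳ : ∀ c x y → B x (c ·ᵥ y) ≡ c ⊗ B x y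
  B-·ʳ c x y = trans (B-sym x _) (trans (B-·ˡ c y x) (cong (c ⊗_) (B-sym y x)))

  B-0ʳ : ∀ x → B x 0ᵥ ≡ 𝟘
  B-0ʳ x = trans (cong (B x) (sym (·ᵥ-zeroˡ 0ᵥ))) (B-·ʳ 𝟘 x 0ᵥ)

  B--ˡ : ∀ x y z → B (x -ᵥ y) z ≡ B x z ⊖ B y z
  B--ˡ x y z = trans (B-+ˡ x _ z) (cong (B x z ⊕_) (B-·ˡ 𝟚 y z))

  B--ʳ : ∀ x y z → B x (y -ᵥ z) ≡ B x y ⊖ B x z
  B--ʳ x y z = trans (B-+ʳ x y _) (cong (B x y ⊕_) (B-·ʳ 𝟚 x z))

  q-0 : q 0ᵥ ≡ 𝟘
  q-0 = trans (cong q (sym (·ᵥ-zeroˡ 0ᵥ))) (q-· 𝟘 0ᵥ)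

  -- Since 4 = 1 in F₃, q (x + x) equals q x; it also equals 2 q x + B x x.
  B-self : ∀ x → B x x ≡ neg (q x)
  B-self x = by-arith (q x) (B x x) (begin
    q x                  ≡⟨ q-· 𝟚 x ⟨
    q (𝟚 ·ᵥ x)           ≡⟨ cong q (·ᵥ-distribʳ 𝟙 𝟙 x) ⟩
    q ((𝟙 ·ᵥ x) +ᵥ (𝟙 ·ᵥ x)) ≡⟨ cong (λ y → q (y +ᵥ y)) (·ᵥ-identityˡ x) ⟩
    q (x +ᵥ x)           ≡⟨ q-+ x x ⟩
    q x ⊕ q x ⊕ B x x    ∎)
    where
    open ≡-Reasoning
    by-arith : ∀ a b → a ≡ a ⊕ a ⊕ b → b ≡ neg a
    by-arith = by-cases (all? λ a → all? λ b → (_ ≟ _) →-dec (_ ≟ _))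

  ⟪_,_⟫ : ∀ {k} → Vecₙ N → Vec (Vecₙ N) k → Vecₙ k
  ⟪ v , X ⟫ = map (B v) X

  ⟪⟫-+ : ∀ {k} v w (X : Vec (Vecₙ N) k) → ⟪ v +ᵥ w , X ⟫ ≡ ⟪ v , X ⟫ +ᵥ ⟪ w , X ⟫
  ⟪⟫-+ v w [] = refl
  ⟪⟫-+ v w (x ∷ X) = cong₂ _∷_ (B-+ˡ v w x) (⟪⟫-+ v w X)

  ⟪⟫-· : ∀ {k} c v (X : Vec (Vecₙ N) k) → ⟪ c ·ᵥ v , X ⟫ ≡ c ·ᵥ ⟪ v , X ⟫
  ⟪⟫-· c v [] = refl
  ⟪⟫-· c v (x ∷ X) = cong₂ _∷_ (B-·ˡ c v x) (⟪⟫-· c v X)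

  ⟪⟫-- : ∀ {k} v w (X : Vec (Vecₙ N) k) → ⟪ v -ᵥ w , X ⟫ ≡ ⟪ v , X ⟫ -ᵥ ⟪ w , X ⟫
  ⟪⟫-- v w X = trans (⟪⟫-+ v _ X) (cong (⟪ v , X ⟫ +ᵥ_) (⟪⟫-· 𝟚 w X))

  B-comb : ∀ {k} v c (X : Vec (Vecₙ N) k) → B v (comb c X) ≡ c ∙ ⟪ v , X ⟫
  B-comb v [] [] = B-0ʳ v
  B-comb v (a ∷ c) (x ∷ X) = trans (B-+ʳ v _ _) (cong₂ _⊕_ (B-·ʳ a v x) (B-comb v c X))

  -- This says B xᵢ yⱼ = δᵢⱼ. Phrased with coefficient vectors, it lets pairing with `Y` recover the
  -- coefficients of a combination of `X`, so independence is immediate.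
  Dual : ∀ {k} → Vec (Vecₙ N) k → Vec (Vecₙ N) k → Set
  Dual X Y = ∀ c → ⟪ comb c X , Y ⟫ ≡ c

  Dual⇒≤ : ∀ {k} {X Y : Vec (Vecₙ N) k} → Dual X Y → k ≤ N
  Dual⇒≤ {X = X} {Y} dual = injective⇒dim≤ (λ c → comb c X) λ {c} {d} e →
    trans (sym (dual c)) (trans (cong (λ v → ⟪ v , Y ⟫) e) (dual d))

  _⊥ᵥ_ : ∀ {k} → Vecₙ N → Vec (Vecₙ N) k → Set
  v ⊥ᵥ X = ⟪ v , X ⟫ ≡ 0ᵥ

  -- For Dual X Y, the projection onto the orthogonal complement of Y along the span of X.
  residual : ∀ {k} (X Y : Vec (Vecₙ N) k) → Vecₙ N → Vecₙ N
  residual X Y v = v -ᵥ comb ⟪ v , Y ⟫ X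

  residual-⊥ : ∀ {k} {X Y : Vec (Vecₙ N) k} → Dual X Y → ∀ v → ⟪ residual X Y v , Y ⟫ ≡ 0ᵥ
  residual-⊥ {X = X} {Y} dual v = begin
    ⟪ residual X Y v , Y ⟫              ≡⟨ ⟪⟫-- v _ Y ⟩
    ⟪ v , Y ⟫ -ᵥ ⟪ comb ⟪ v , Y ⟫ X , Y ⟫ ≡⟨ cong (⟪ v , Y ⟫ -ᵥ_) (dual ⟪ v , Y ⟫) ⟩
    ⟪ v , Y ⟫ -ᵥ ⟪ v , Y ⟫                ≡⟨ -ᵥ-self ⟪ v , Y ⟫ ⟩
    0ᵥ                                  ∎
    where open ≡-Reasoning

  residual-trivial : ∀ {k} {X Y : Vec (Vecₙ N) k} {v} → v ⊥ᵥ Y → residual X Y v ≡ v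
  residual-trivial {X = X} {v = v} v⊥Y =
    trans (cong (v -ᵥ_) (trans (cong (λ c → comb c X) v⊥Y) (comb-zero X))) (x-0≡x v)

  B-residual : ∀ {k} (X Y : Vec (Vecₙ N) k) v w → B (residual X Y v) w ≡ B v w ⊖ ⟪ v , Y ⟫ ∙ ⟪ w , X ⟫
  B-residual X Y v w = trans (B--ˡ v _ w) (cong (B v w ⊖_) (trans (B-sym _ w) (B-comb w ⟪ v , Y ⟫ X)))

  -- Both sides equal B v w ⊖ ⟪ v , Y ⟫ ∙ ⟪ w , X ⟫, which is symmetric under exchanging (v , Y)
  -- with (w , X).
  residual-adjoint : ∀ {k} (X Y : Vec (Vecₙ N) k) v w → B (residual X Y v) w ≡ B v (residual Y X w)
  residual-adjoint X Y v w = begin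
    B (residual X Y v) w              ≡⟨ B-residual X Y v w ⟩
    B v w ⊖ ⟪ v , Y ⟫ ∙ ⟪ w , X ⟫       ≡⟨ cong₂ _⊖_ (B-sym v w) (∙-comm ⟪ v , Y ⟫ ⟪ w , X ⟫) ⟩
    B w v ⊖ ⟪ w , X ⟫ ∙ ⟪ v , Y ⟫       ≡⟨ B-residual Y X w v ⟨
    B (residual Y X w) v              ≡⟨ B-sym _ v ⟩
    B v (residual Y X w)              ∎
    where open ≡-Reasoning

  ⊥ᵥ⇒⊥comb : ∀ {k} {v} {X : Vec (Vecₙ N) k} → v ⊥ᵥ X → ∀ c → B v (comb c X) ≡ 𝟘
  ⊥ᵥ⇒⊥comb {v = v} {X} v⊥X c = trans (B-comb v c X) (trans (cong (c ∙_) v⊥X) (∙-zeroʳ c))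

  ⊥ᵥ-subspace : ∀ {k} (Y : Vec (Vecₙ N) k) → Subspace (_⊥ᵥ Y)
  ⊥ᵥ-subspace Y = record
    { 0∈ = trans (cong (λ v → ⟪ v , Y ⟫) (sym (·ᵥ-zeroˡ 0ᵥ))) (trans (⟪⟫-· 𝟘 0ᵥ Y) (·ᵥ-zeroˡ ⟪ 0ᵥ , Y ⟫))
    ; +∈ = λ {v} {w} v⊥ w⊥ → trans (⟪⟫-+ v w Y) (trans (cong₂ _+ᵥ_ v⊥ w⊥) (+ᵥ-identityˡ 0ᵥ))
    ; ·∈ = λ c {v} v⊥ → trans (⟪⟫-· c v Y) (trans (cong (c ·ᵥ_) v⊥) (·ᵥ-zeroʳ c)) }

  Dual-sym : ∀ {k} {X Y : Vec (Vecₙ N) k} → Dual X Y → Dual Y X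
  Dual-sym {X = X} {Y} dual c = ∙-nondegenerate _ c λ d → begin
    d ∙ ⟪ comb c Y , X ⟫        ≡⟨ B-comb (comb c Y) d X ⟨
    B (comb c Y) (comb d X)     ≡⟨ B-sym (comb c Y) _ ⟩
    B (comb d X) (comb c Y)     ≡⟨ B-comb (comb d X) c Y ⟩
    c ∙ ⟪ comb d X , Y ⟫        ≡⟨ cong (c ∙_) (dual d) ⟩
    c ∙ d                       ≡⟨ ∙-comm c d ⟩
    d ∙ c                       ∎
    where open ≡-Reasoning

  -- The new dual vector is corrected to be orthogonal to X, and the old ones to x.
  Dual-∷ : ∀ {k} {X Y : Vec (Vecₙ N) k} → Dual X Y → ∀ x y → y ⊥ᵥ X → B x y ≡ 𝟙 →
           Dual (x ∷ X) (y ∷ map (λ u → u -ᵥ (B x u ·ᵥ y)) Y)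
  Dual-∷ {X = X} {Y} dual x y y⊥X Bxy≡1 (a ∷ c) = cong₂ _∷_ head (trans (tail Y) (dual c))
    where
    open ≡-Reasoning
    B-cons : ∀ v → B ((a ·ᵥ x) +ᵥ comb c X) v ≡ a ⊗ B x v ⊕ B (comb c X) v
    B-cons v = trans (B-+ˡ _ _ v) (cong (_⊕ B (comb c X) v) (B-·ˡ a x v))
    combX⊥y : B (comb c X) y ≡ 𝟘
    combX⊥y = trans (B-sym _ y) (⊥ᵥ⇒⊥comb y⊥X c)
    head : B ((a ·ᵥ x) +ᵥ comb c X) y ≡ a
    head = trans (B-cons y) (trans (cong₂ _⊕_ (trans (cong (a ⊗_) Bxy≡1) (⊗-identityʳ a)) combX⊥y) (⊕-identityʳ a))
    step : ∀ u → B ((a ·ᵥ x) +ᵥ comb c X) (u -ᵥ (B x u ·ᵥ y)) ≡ B (comb c X) u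
    step u = begin
      B ((a ·ᵥ x) +ᵥ comb c X) (u -ᵥ (B x u ·ᵥ y))
        ≡⟨ B--ʳ _ u _ ⟩
      B ((a ·ᵥ x) +ᵥ comb c X) u ⊖ B ((a ·ᵥ x) +ᵥ comb c X) (B x u ·ᵥ y)
        ≡⟨ cong₂ _⊖_ (B-cons u) (trans (B-·ʳ (B x u) _ y) (cong (B x u ⊗_) head)) ⟩
      a ⊗ B x u ⊕ B (comb c X) u ⊖ B x u ⊗ a
        ≡⟨ solve 3 (λ a b c → (a :* b :+ c) :+ (:- (b :* a)) := c) refl a (B x u) (B (comb c X) u) ⟩
      B (comb c X) u ∎
    tail : ∀ {l} (U : Vec (Vecₙ N) l) →
           ⟪ (a ·ᵥ x) +ᵥ comb c X , map (λ u → u -ᵥ (B x u ·ᵥ y)) U ⟫ ≡ ⟪ comb c X , U ⟫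
    tail [] = refl
    tail (u ∷ U) = cong₂ _∷_ (step u) (tail U)

  -- Maximal dual systems.

  record DualSystem (A T : Vecₙ N → Set) : Set where
    field
      size : ℕ
      X Y  : Vec (Vecₙ N) size
      X∈A  : VAll.All A X
      Y∈T  : VAll.All T Y
      dual : Dual X Y

  module _ {A T : Vecₙ N → Set} (A? : ∀ x → Dec (A x)) (T? : ∀ x → Dec (T x)) (T-subspace : Subspace T) where

    open Subspace T-subspace

    Extensible : DualSystem A T → Set
    Extensible D = ∃ λ a → A a × ∃ λ t → T t × B (residual X Y a) t ≢ 𝟘
      where open DualSystem D

    extend : (D : DualSystem A T) → Extensible D → DualSystem A T
    extend D (a , a∈A , t , t∈T , β≢0) = record
      { size = suc size
      ; X = a ∷ X
      ; Y = y ∷ map (λ u → u -ᵥ (B a u ·ᵥ y)) Y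
      ; X∈A = a∈A ∷ X∈A
      ; Y∈T = y∈T ∷ VAll.map⁺ (VAll.map (λ u∈T → -∈ u∈T (·∈ (B a _) y∈T)) Y∈T)
      ; dual = Dual-∷ dual a y
          (trans (⟪⟫-· β _ X) (trans (cong (β ·ᵥ_) (residual-⊥ (Dual-sym dual) t)) (·ᵥ-zeroʳ β)))
          (trans (B-·ʳ β a _) (trans (cong (β ⊗_) (sym (residual-adjoint X Y a t))) (≢0⇒square≡1 β β≢0))) }
      where
      open DualSystem D
      β : F₃
      β = B (residual X Y a) t
      y : Vecₙ N
      -- The residual is orthogonal to `X`, and by adjointness its product with `a` is β. Since β² =
      -- 1, the factor β normalises this product to 1.
      y = β ·ᵥ residual Y X t
      y∈T : T y
      y∈T = ·∈ β (-∈ t∈T (comb∈ ⟪ t , X ⟫ Y∈T))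

    extensible? : (D : DualSystem A T) → Dec (Extensible D)
    extensible? D = anyVector? λ a → A? a ×-dec anyVector? λ t → T? t ×-dec ¬? (_ ≟ _)

    -- In other words `X` spans `A` modulo the vectors orthogonal to `T`, so `size` is the rank of
    -- the pairing between `A` and `T`.
    Saturated : DualSystem A T → Set
    Saturated D = ∀ {a t} → A a → T t → B (residual X Y a) t ≡ 𝟘
      where open DualSystem D

    abstract

      saturated-system : ∃ Saturated
      saturated-system = grow (suc N)
        (record { size = 0 ; X = [] ; Y = [] ; X∈A = [] ; Y∈T = [] ; dual = λ { [] → refl } })
        (ℕ.+-identityʳ (suc N))
        where
        grow : ∀ fuel (D : DualSystem A T) → fuel + DualSystem.size D ≡ suc N → ∃ Saturated
        -- Fuel plus size is always `suc N`, so exhausted fuel would mean a dual system of size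
        -- `suc N`, beyond the bound of `Dual⇒≤`.
        grow zero       D e = contradiction (Dual⇒≤ (DualSystem.dual D)) (ℕ.<⇒≱ (ℕ.≤-reflexive (sym e)))
        grow (suc fuel) D e with extensible? D
        ... | yes ext = grow fuel (extend D ext) (trans (ℕ.+-suc fuel _) e)
        ... | no ¬ext = D , λ {a} {t} a∈A t∈T →
                decidable-stable (_ ≟ _) λ β≢0 → ¬ext (a , a∈A , t , t∈T , β≢0)

-- Gram matrices and codes of coclique members.

data UpperTriangle : ℕ → Set where
  []  : UpperTriangle 0
  _∷_ : ∀ {n} → Vecₙ n → UpperTriangle n → UpperTriangle (suc n)

-- An upper triangle G stands for the symmetric matrix with zero diagonal; apply G c is
-- its product with c, and form G c is half the value of its quadratic form at c.
form : ∀ {n} → UpperTriangle n → Vecₙ n → F₃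
form []      []      = 𝟘
form (r ∷ G) (a ∷ c) = a ⊗ c ∙ r ⊕ form G c

apply : ∀ {n} → UpperTriangle n → Vecₙ n → Vecₙ n
apply []      []      = []
apply (r ∷ G) (a ∷ c) = c ∙ r ∷ ((a ·ᵥ r) +ᵥ apply G c)

ZeroTwo : ∀ {n} → Vecₙ n → Set
ZeroTwo = VAll.All (_≢ 𝟙)

zeroTwos : ∀ n → List (Vecₙ n)
zeroTwos zero    = [] ∷ []
zeroTwos (suc n) = cartesianProductWith _∷_ (𝟘 ∷ 𝟚 ∷ []) (zeroTwos n)

∈-zeroTwos : ∀ {n} {x : Vecₙ n} → ZeroTwo x → x ∈ zeroTwos n
∈-zeroTwos [] = here refl
∈-zeroTwos {x = a ∷ x} (a≢𝟙 ∷ x≢𝟙) = ∈-cartesianProductWith⁺ _∷_ (a∈ a a≢𝟙) (∈-zeroTwos x≢𝟙)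
  where
  a∈ : ∀ a → a ≢ 𝟙 → a ∈ 𝟘 ∷ 𝟚 ∷ []
  a∈ 𝟘 _ = here refl
  a∈ 𝟙 a≢𝟙 = contradiction refl a≢𝟙
  a∈ 𝟚 _ = there (here refl)

length-zeroTwos : ∀ n → length (zeroTwos n) ≡ 2 ^ n
length-zeroTwos zero    = refl
length-zeroTwos (suc n) = trans (length-cartesianProductWith _∷_ (𝟘 ∷ 𝟚 ∷ []) (zeroTwos n))
                                (cong (2 *_) (length-zeroTwos n))

triangles : ∀ n → List (UpperTriangle n)
triangles zero    = [] ∷ []
triangles (suc n) = cartesianProductWith _∷_ (zeroTwos n) (triangles n)

-- The traces on codes of two properties of a member z: z is singular, and its products with the
-- chosen n vectors are 0 or 2.
Admissible : ∀ {n} → UpperTriangle n → Vecₙ n → Set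
Admissible G c = form G c ≡ 𝟘 × ZeroTwo (apply G c)

-- If `form G` vanishes at c and at d, its value at c + d is the product of the two vectors coded,
-- and members never have product 1.
Compatible : ∀ {n} → UpperTriangle n → Vecₙ n → Vecₙ n → Set
Compatible G c d = form G (c +ᵥ d) ≢ 𝟙

-- What a coclique of size len in dimension N provides: n vectors with Gram matrix G, and
-- for each member a code c ∈ F₃ⁿ (its coefficients on these vectors modulo the radical)
-- together with k coordinates in the radical.  The field bound counts members by any φ
-- that is injective on pairwise compatible admissible codes.
record Coding (N len : ℕ) : Set where
  field
    n k         : ℕ
    size≤       : n + k + 1 + k ≤ N
    G           : UpperTriangle n
    G∈triangles : G ∈ triangles n
    nonsingular : ∀ {c d} → apply G c ≡ apply G d → c ≡ d
    bound       : ∀ (φ : Vecₙ n → Vecₙ n) {L} → (∀ {c} → Admissible G c → φ c ∈ L) →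
                  (∀ {c d} → Admissible G c → Admissible G d → Compatible G c d → φ c ≡ φ d → c ≡ d) →
                  len ≤ length L * 3 ^ k

-- From a normalised coclique to its coding.

module _ {N} (S : QuadraticSpace N) where

  open Space S

  -- Pairing a relation with `Y` kills the part in `W` and returns the coefficients on `X`, which
  -- therefore vanish.
  independent-++ : ∀ {k l} {W : Vec (Vecₙ N) k} {X Y : Vec (Vecₙ N) l} → Independent W → Dual X Y →
                   VAll.All (_⊥ᵥ Y) W → Independent (W ++ X)
  independent-++ {k} {l} {W} {X} {Y} indep dual W⊥Y e e≡0 with splitAt k e
  ... | c , d , refl = trans (cong₂ _++_ c≡0 d≡0) (zeros k)
    where
    zeros : ∀ k → 0ᵥ {k} ++ 0ᵥ {l} ≡ 0ᵥ
    zeros zero = refl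
    zeros (suc k) = cong (𝟘 ∷_) (zeros k)
    open ≡-Reasoning
    ⊥Y : Subspace (_⊥ᵥ Y)
    ⊥Y = ⊥ᵥ-subspace Y
    d≡0 : d ≡ 0ᵥ
    d≡0 = begin
      d                                  ≡⟨ dual d ⟨
      ⟪ comb d X , Y ⟫                   ≡⟨ +ᵥ-identityˡ _ ⟨
      0ᵥ +ᵥ ⟪ comb d X , Y ⟫             ≡⟨ cong (_+ᵥ ⟪ comb d X , Y ⟫) (Subspace.comb∈ ⊥Y c W⊥Y) ⟨
      ⟪ comb c W , Y ⟫ +ᵥ ⟪ comb d X , Y ⟫ ≡⟨ ⟪⟫-+ (comb c W) _ Y ⟨
      ⟪ comb c W +ᵥ comb d X , Y ⟫       ≡⟨ cong (λ v → ⟪ v , Y ⟫) (comb-++ c d W X) ⟨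
      ⟪ comb (c ++ d) (W ++ X) , Y ⟫     ≡⟨ cong (λ v → ⟪ v , Y ⟫) e≡0 ⟩
      ⟪ 0ᵥ , Y ⟫                         ≡⟨ Subspace.0∈ ⊥Y ⟩
      0ᵥ                                 ∎
    c≡0 : c ≡ 0ᵥ
    c≡0 = indep c (begin
      comb c W                    ≡⟨ +ᵥ-identityʳ _ ⟨
      comb c W +ᵥ 0ᵥ              ≡⟨ cong (comb c W +ᵥ_) (trans (cong (λ d → comb d X) d≡0) (comb-zero X)) ⟨
      comb c W +ᵥ comb d X        ≡⟨ comb-++ c d W X ⟨
      comb (c ++ d) (W ++ X)      ≡⟨ e≡0 ⟩
      0ᵥ                          ∎)

  ⊥⇒⊥ᵥ : ∀ {l v} {V : Vec (Vecₙ N) l} → VAll.All (λ w → B v w ≡ 𝟘) V → v ⊥ᵥ V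
  ⊥⇒⊥ᵥ [] = refl
  ⊥⇒⊥ᵥ (v⊥w ∷ v⊥V) = cong₂ _∷_ v⊥w (⊥⇒⊥ᵥ v⊥V)

  ⊥ᵥ-swap : ∀ {k l} {V : Vec (Vecₙ N) k} {W : Vec (Vecₙ N) l} → VAll.All (_⊥ᵥ V) W → VAll.All (_⊥ᵥ W) V
  ⊥ᵥ-swap {V = []} W⊥V = []
  ⊥ᵥ-swap {V = v ∷ V} W⊥V =
    ⊥⇒⊥ᵥ (VAll.map (λ {w} w⊥ → trans (B-sym v w) (Vec.∷-injectiveˡ w⊥)) W⊥V)
    ∷ ⊥ᵥ-swap (VAll.map Vec.∷-injectiveʳ W⊥V)

  Dual⇒Independent : ∀ {k} {X Y : Vec (Vecₙ N) k} → Dual X Y → Independent X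
  Dual⇒Independent {Y = Y} dual c e =
    trans (sym (dual c)) (trans (cong (λ v → ⟪ v , Y ⟫) e) (Subspace.0∈ (⊥ᵥ-subspace Y)))

  Singular : Vecₙ N → Set
  Singular x = q x ≡ 𝟘

  Singular⇒B-self : ∀ {x} → Singular x → B x x ≡ 𝟘
  Singular⇒B-self {x} qx≡0 = trans (B-self x) (cong neg qx≡0)

  gram : ∀ {n} → Vec (Vecₙ N) n → UpperTriangle n
  gram []      = []
  gram (x ∷ X) = ⟪ x , X ⟫ ∷ gram X

  form-gram : ∀ {n} {X : Vec (Vecₙ N) n} → VAll.All Singular X → ∀ c → q (comb c X) ≡ form (gram X) c
  form-gram [] [] = q-0
  form-gram {X = x ∷ X} (qx≡0 ∷ sing) (a ∷ c) = begin
    q ((a ·ᵥ x) +ᵥ comb c X)                     ≡⟨ q-+ _ _ ⟩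
    q (a ·ᵥ x) ⊕ q (comb c X) ⊕ B (a ·ᵥ x) (comb c X)
      ≡⟨ cong₂ _⊕_ (cong₂ _⊕_ (trans (q-· a x) (trans (cong (a ⊗ a ⊗_) qx≡0) (⊗-zeroʳ (a ⊗ a)))) (form-gram sing c))
           (trans (B-·ˡ a x _) (cong (a ⊗_) (B-comb x c X))) ⟩
    form (gram X) c ⊕ a ⊗ c ∙ ⟪ x , X ⟫           ≡⟨ ⊕-comm (form (gram X) c) _ ⟩
    a ⊗ c ∙ ⟪ x , X ⟫ ⊕ form (gram X) c           ∎
    where open ≡-Reasoning

  apply-gram : ∀ {n} {X : Vec (Vecₙ N) n} → VAll.All Singular X → ∀ c → ⟪ comb c X , X ⟫ ≡ apply (gram X) c
  apply-gram [] [] = refl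
  apply-gram {X = x ∷ X} (qx≡0 ∷ sing) (a ∷ c) = cong₂ _∷_
    (trans (B-+ˡ _ _ x) (cong₂ _⊕_
      (trans (B-·ˡ a x x) (trans (cong (a ⊗_) (Singular⇒B-self qx≡0)) (⊗-zeroʳ a)))
      (trans (B-sym _ x) (B-comb x c X))))
    (trans (⟪⟫-+ _ _ X) (cong₂ _+ᵥ_ (⟪⟫-· a x X) (apply-gram sing c)))

  -- Z is a normalised coclique: subtracting the vertex x₀ from a coclique
  -- whose representatives y satisfy B x₀ y = 2 gives such a list.
  module _ (x₀ : Vecₙ N) (qx₀≡1 : q x₀ ≡ 𝟙) (Z : List (Vecₙ N)) (Z-unique : Unique Z)
           (singular : ∀ {z} → z ∈ Z → Singular z) (⊥x₀ : ∀ {z} → z ∈ Z → B z x₀ ≡ 𝟘)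
           (B≢1 : ∀ {z w} → z ∈ Z → w ∈ Z → B z w ≢ 𝟙) where

    Perp : Vecₙ N → Set
    Perp t = All (λ z → B z t ≡ 𝟘) Z

    Perp? : ∀ t → Dec (Perp t)
    Perp? t = All.all? (λ z → B z t ≟ 𝟘) Z

    -- By nondegeneracy this is the span of `Z`. In this form it is decidable by search, and its
    -- orthogonality to `Perp` holds by definition.
    PerpPerp : Vecₙ N → Set
    PerpPerp u = ∀ t → Perp t → B t u ≡ 𝟘

    PerpPerp? : ∀ u → Dec (PerpPerp u)
    PerpPerp? u = allVectors? λ t → Perp? t →-dec (_ ≟ _)

    ⊥-subspace : ∀ z → Subspace (λ t → B z t ≡ 𝟘)
    ⊥-subspace z = record
      { 0∈ = B-0ʳ z
      ; +∈ = λ {x} {y} zx zy → trans (B-+ʳ z x y) (cong₂ _⊕_ zx zy)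
      ; ·∈ = λ c {x} zx → trans (B-·ʳ c z x) (trans (cong (c ⊗_) zx) (⊗-zeroʳ c)) }

    PerpPerp-subspace : Subspace PerpPerp
    PerpPerp-subspace = record
      { 0∈ = λ t _ → Subspace.0∈ (⊥-subspace t)
      ; +∈ = λ ux uy t p → Subspace.+∈ (⊥-subspace t) (ux t p) (uy t p)
      ; ·∈ = λ c ux t p → Subspace.·∈ (⊥-subspace t) c (ux t p) }

    Z⊆PerpPerp : ∀ {z} → z ∈ Z → PerpPerp z
    Z⊆PerpPerp z∈Z t t∈Perp = trans (B-sym t _) (All.lookup t∈Perp z∈Z)

    Radical : Vecₙ N → Set
    Radical r = PerpPerp r × Perp r

    ∈Z? : ∀ z → Dec (z ∈ Z)
    ∈Z? z = Any.any? (z ≟ᵥ_) Z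

    -- The family `X` is taken from `Z` itself, so its vectors are singular with mutual products 0
    -- or 2; its size n is the rank of the Gram matrix of `Z`.
    core : ∃ (Saturated ∈Z? PerpPerp? PerpPerp-subspace)
    core = saturated-system ∈Z? PerpPerp? PerpPerp-subspace

    open DualSystem (proj₁ core) using (X; Y; dual) renaming (size to n; X∈A to X∈Z; Y∈T to Y∈PerpPerp)

    Radical? : ∀ r → Dec (Radical r)
    Radical? r = PerpPerp? r ×-dec Perp? r

    ⊥X? : ∀ t → Dec (t ⊥ᵥ X)
    ⊥X? t = ⟪ t , X ⟫ ≟ᵥ 0ᵥ

    -- Partners of the radical are sought orthogonal to `X`, so that `X` can be joined to `R`
    -- independently. That this restriction loses nothing is `Radical-determined`.
    radical : ∃ (Saturated Radical? ⊥X? (⊥ᵥ-subspace X))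
    radical = saturated-system Radical? ⊥X? (⊥ᵥ-subspace X)

    open DualSystem (proj₁ radical) using ()
      renaming (size to k; X to R; Y to T; X∈A to R∈Radical; Y∈T to T⊥X; dual to R-dual)

    residual∈Radical : ∀ {z} → z ∈ Z → Radical (residual X Y z)
    residual∈Radical {z} z∈Z =
      Subspace.-∈ PerpPerp-subspace (Z⊆PerpPerp z∈Z)
        (Subspace.comb∈ PerpPerp-subspace ⟪ z , Y ⟫ (VAll.map Z⊆PerpPerp X∈Z))
      , All.tabulate λ {w} w∈Z → trans (B-sym w _) (proj₂ core z∈Z (Z⊆PerpPerp w∈Z))

    ⊥radical : ∀ {u r} → PerpPerp u → Perp r → B u r ≡ 𝟘
    ⊥radical u∈ r∈ = trans (B-sym _ _) (u∈ _ r∈)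

    -- A vector r of the radical is orthogonal to `Y`, so replacing v by `residual Y X v` does not
    -- change B r v. The new vector is orthogonal to `X`, where saturation of `radical` applies.
    Radical-determined : ∀ {r} → Radical r → ⟪ r , T ⟫ ≡ 0ᵥ → r ≡ 0ᵥ
    Radical-determined {r} r∈@(_ , r∈Perp) r⊥T = nondegenerate r λ v → begin
      B r v                                     ≡⟨ ⊕-identityʳ _ ⟨
      B r v ⊖ 𝟘                                 ≡⟨ cong (B r v ⊖_) (trans (B-sym r _)
                                                     (⊥radical (Subspace.comb∈ PerpPerp-subspace ⟪ v , X ⟫ Y∈PerpPerp) r∈Perp)) ⟨
      B r v ⊖ B r (comb ⟪ v , X ⟫ Y)            ≡⟨ B--ʳ r v _ ⟨
      B r (residual Y X v)                      ≡⟨ cong (λ s → B s (residual Y X v)) (residual-trivial r⊥T) ⟨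
      B (residual R T r) (residual Y X v)       ≡⟨ proj₂ radical r∈ (residual-⊥ (Dual-sym dual) v) ⟩
      𝟘                                         ∎
      where open ≡-Reasoning

    -- The products of z with `Z` depend only on ⟪ z , Y ⟫. Hence equal `Y`-coordinates put z - w
    -- into the radical, where the `T`-coordinates decide.
    coordinates-injective : ∀ {z w} → z ∈ Z → w ∈ Z → ⟪ z , Y ⟫ ≡ ⟪ w , Y ⟫ → ⟪ z , T ⟫ ≡ ⟪ w , T ⟫ → z ≡ w
    coordinates-injective {z} {w} z∈Z w∈Z zY≡wY zT≡wT = x-y≡0⇒x≡y z w (Radical-determined z-w∈Radical (⟪-⟫≡0 zT≡wT))
      where
      ⟪-⟫≡0 : ∀ {l} {V : Vec (Vecₙ N) l} → ⟪ z , V ⟫ ≡ ⟪ w , V ⟫ → ⟪ z -ᵥ w , V ⟫ ≡ 0ᵥ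
      ⟪-⟫≡0 {V = V} e = trans (⟪⟫-- z w V) (trans (cong (_-ᵥ ⟪ w , V ⟫) e) (-ᵥ-self ⟪ w , V ⟫))
      z-w∈PerpPerp : PerpPerp (z -ᵥ w)
      z-w∈PerpPerp = Subspace.-∈ PerpPerp-subspace (Z⊆PerpPerp z∈Z) (Z⊆PerpPerp w∈Z)
      z-w∈Radical : Radical (z -ᵥ w)
      z-w∈Radical = z-w∈PerpPerp , All.tabulate λ {u} u∈Z → begin
        B u (z -ᵥ w)                ≡⟨ B--ʳ u z w ⟩
        B u z ⊖ B u w               ≡⟨ cong₂ _⊖_ (B-via-core u∈Z z∈Z) (B-via-core u∈Z w∈Z) ⟩
        ⟪ z , Y ⟫ ∙ ⟪ u , X ⟫ ⊖ ⟪ w , Y ⟫ ∙ ⟪ u , X ⟫ ≡⟨ cong (λ c → ⟪ z , Y ⟫ ∙ ⟪ u , X ⟫ ⊖ c ∙ ⟪ u , X ⟫) zY≡wY ⟨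
        ⟪ z , Y ⟫ ∙ ⟪ u , X ⟫ ⊖ ⟪ z , Y ⟫ ∙ ⟪ u , X ⟫ ≡⟨ ⊕-inverseʳ (⟪ z , Y ⟫ ∙ ⟪ u , X ⟫) ⟩
        𝟘                           ∎
        where
        open ≡-Reasoning
        B-via-core : ∀ {u z} → u ∈ Z → z ∈ Z → B u z ≡ ⟪ z , Y ⟫ ∙ ⟪ u , X ⟫
        B-via-core {u} {z} u∈Z z∈Z = x⊖y≡0⇒x≡y _ _ (begin
          B u z ⊖ ⟪ z , Y ⟫ ∙ ⟪ u , X ⟫   ≡⟨ cong (_⊖ ⟪ z , Y ⟫ ∙ ⟪ u , X ⟫) (B-sym u z) ⟩
          B z u ⊖ ⟪ z , Y ⟫ ∙ ⟪ u , X ⟫   ≡⟨ B-residual X Y z u ⟨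
          B (residual X Y z) u            ≡⟨ proj₂ core z∈Z (Z⊆PerpPerp u∈Z) ⟩
          𝟘                               ∎)

    X-singular : VAll.All Singular X
    X-singular = VAll.map singular X∈Z

    component : Vecₙ N → Vecₙ N
    component z = comb ⟪ z , Y ⟫ X

    component-residual : ∀ z → component z +ᵥ residual X Y z ≡ z
    component-residual z = x+[y-x]≡y (component z) z

    residual-singular : ∀ {z} → z ∈ Z → Singular (residual X Y z)
    residual-singular {z} z∈Z = neg≡0⇒≡0 (q (residual X Y z)) (trans (sym (B-self _)) (⊥radical ρ∈PerpPerp ρ∈Perp))
      where
      ρ∈PerpPerp = proj₁ (residual∈Radical z∈Z)
      ρ∈Perp = proj₂ (residual∈Radical z∈Z)

    component∈PerpPerp : ∀ z → PerpPerp (component z)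
    component∈PerpPerp z = Subspace.comb∈ PerpPerp-subspace ⟪ z , Y ⟫ (VAll.map Z⊆PerpPerp X∈Z)

    -- The residual lies in the radical, so it is singular and orthogonal to the component; only the
    -- component contributes to q z.
    component-singular : ∀ {z} → z ∈ Z → Singular (component z)
    component-singular {z} z∈Z = begin
      q (component z)                                ≡⟨ ⊕-identityʳ _ ⟨
      q (component z) ⊕ 𝟘                            ≡⟨ ⊕-identityʳ _ ⟨
      q (component z) ⊕ 𝟘 ⊕ 𝟘
        ≡⟨ cong₂ (λ a b → q (component z) ⊕ a ⊕ b) (residual-singular z∈Z)
             (⊥radical (component∈PerpPerp z) (proj₂ (residual∈Radical z∈Z))) ⟨
      q (component z) ⊕ q (residual X Y z) ⊕ B (component z) (residual X Y z) ≡⟨ q-+ (component z) _ ⟨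
      q (component z +ᵥ residual X Y z)              ≡⟨ cong q (component-residual z) ⟩
      q z                                            ≡⟨ singular z∈Z ⟩
      𝟘                                              ∎
      where open ≡-Reasoning

    B-component : ∀ {z u} → z ∈ Z → PerpPerp u → B (component z) u ≡ B z u
    B-component {z} {u} z∈Z u∈ = begin
      B (component z) u                              ≡⟨ ⊕-identityʳ _ ⟨
      B (component z) u ⊕ 𝟘                          ≡⟨ cong (B (component z) u ⊕_) (proj₂ core z∈Z u∈) ⟨
      B (component z) u ⊕ B (residual X Y z) u       ≡⟨ B-+ˡ (component z) _ u ⟨
      B (component z +ᵥ residual X Y z) u            ≡⟨ cong (λ v → B v u) (component-residual z) ⟩
      B z u                                          ∎
      where open ≡-Reasoning

    G₀ : UpperTriangle n
    G₀ = gram X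

    admissible : ∀ {z} → z ∈ Z → Admissible G₀ ⟪ z , Y ⟫
    admissible {z} z∈Z =
      trans (sym (form-gram X-singular ⟪ z , Y ⟫)) (component-singular z∈Z) ,
      subst ZeroTwo (apply-gram X-singular ⟪ z , Y ⟫)
        (VAll.map⁺ (VAll.map (λ x∈Z e → B≢1 z∈Z x∈Z (trans (sym (B-component z∈Z (Z⊆PerpPerp x∈Z))) e)) X∈Z))

    compatible : ∀ {z w} → z ∈ Z → w ∈ Z → Compatible G₀ ⟪ z , Y ⟫ ⟪ w , Y ⟫
    compatible {z} {w} z∈Z w∈Z e = B≢1 z∈Z w∈Z (begin
      B z w                                      ≡⟨ B-component z∈Z (Z⊆PerpPerp w∈Z) ⟨
      B (component z) w                          ≡⟨ B-sym _ w ⟩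
      B w (component z)                          ≡⟨ B-component w∈Z (component∈PerpPerp z) ⟨
      B (component w) (component z)              ≡⟨ B-sym _ (component z) ⟩
      𝟘 ⊕ 𝟘 ⊕ B (component z) (component w)
        ≡⟨ cong₂ (λ a b → a ⊕ b ⊕ B (component z) (component w)) (component-singular z∈Z) (component-singular w∈Z) ⟨
      q (component z) ⊕ q (component w) ⊕ B (component z) (component w) ≡⟨ q-+ (component z) _ ⟨
      q (component z +ᵥ component w)             ≡⟨ cong q (comb-+ ⟪ z , Y ⟫ ⟪ w , Y ⟫ X) ⟨
      q (comb (⟪ z , Y ⟫ +ᵥ ⟪ w , Y ⟫) X)        ≡⟨ form-gram X-singular _ ⟩
      form G₀ (⟪ z , Y ⟫ +ᵥ ⟪ w , Y ⟫)           ≡⟨ e ⟩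
      𝟙                                          ∎)
      where open ≡-Reasoning

    -- The combination of `X` with coefficients c - d is orthogonal to `X`, hence to every component
    -- and so to `Z`. Then it is orthogonal to `Y`, and pairing with `Y` returns c - d.
    G₀-nonsingular : ∀ {c d} → apply G₀ c ≡ apply G₀ d → c ≡ d
    G₀-nonsingular {c} {d} e = x-y≡0⇒x≡y c d (trans (sym (dual (c -ᵥ d))) (⟪⟫≡0 Y∈PerpPerp))
      where
      v = comb (c -ᵥ d) X
      v⊥X : v ⊥ᵥ X
      v⊥X = begin
        ⟪ v , X ⟫                                ≡⟨ cong (λ w → ⟪ w , X ⟫) (comb-- c d X) ⟩
        ⟪ comb c X -ᵥ comb d X , X ⟫              ≡⟨ ⟪⟫-- (comb c X) _ X ⟩
        ⟪ comb c X , X ⟫ -ᵥ ⟪ comb d X , X ⟫      ≡⟨ cong₂ _-ᵥ_ (apply-gram X-singular c) (apply-gram X-singular d) ⟩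
        apply G₀ c -ᵥ apply G₀ d                 ≡⟨ cong (_-ᵥ apply G₀ d) e ⟩
        apply G₀ d -ᵥ apply G₀ d                 ≡⟨ -ᵥ-self (apply G₀ d) ⟩
        0ᵥ                                       ∎
        where open ≡-Reasoning
      v∈Perp : Perp v
      v∈Perp = All.tabulate λ {z} z∈Z → begin
        B z v                  ≡⟨ B-component z∈Z (Subspace.comb∈ PerpPerp-subspace (c -ᵥ d) (VAll.map Z⊆PerpPerp X∈Z)) ⟨
        B (component z) v      ≡⟨ B-sym _ v ⟩
        B v (component z)      ≡⟨ ⊥ᵥ⇒⊥comb v⊥X ⟪ z , Y ⟫ ⟩
        𝟘                      ∎
        where open ≡-Reasoning
      ⟪⟫≡0 : ∀ {l} {U : Vec (Vecₙ N) l} → VAll.All PerpPerp U → ⟪ v , U ⟫ ≡ 0ᵥ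
      ⟪⟫≡0 [] = refl
      ⟪⟫≡0 (u∈ ∷ U∈) = cong₂ _∷_ (u∈ v v∈Perp) (⟪⟫≡0 U∈)

    gram∈triangles : ∀ {l} {V : Vec (Vecₙ N) l} → VAll.All (_∈ Z) V → gram V ∈ triangles l
    gram∈triangles [] = here refl
    gram∈triangles (v∈Z ∷ V∈Z) = ∈-cartesianProductWith⁺ _∷_
      (∈-zeroTwos (VAll.map⁺ (VAll.map (B≢1 v∈Z) V∈Z))) (gram∈triangles V∈Z)

    x₀-dual : Dual (x₀ ∷ []) ((𝟚 ·ᵥ x₀) ∷ [])
    x₀-dual (a ∷ []) = cong (_∷ []) (begin
      B ((a ·ᵥ x₀) +ᵥ 0ᵥ) (𝟚 ·ᵥ x₀)   ≡⟨ cong (λ v → B v (𝟚 ·ᵥ x₀)) (+ᵥ-identityʳ (a ·ᵥ x₀)) ⟩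
      B (a ·ᵥ x₀) (𝟚 ·ᵥ x₀)           ≡⟨ trans (B-·ˡ a x₀ _) (cong (a ⊗_) (B-·ʳ 𝟚 x₀ x₀)) ⟩
      a ⊗ (𝟚 ⊗ B x₀ x₀)               ≡⟨ cong (λ b → a ⊗ (𝟚 ⊗ b)) (trans (B-self x₀) (cong neg qx₀≡1)) ⟩
      a ⊗ 𝟙                           ≡⟨ ⊗-identityʳ a ⟩
      a                               ∎)
      where open ≡-Reasoning

    x₀∈Perp : Perp x₀
    x₀∈Perp = All.tabulate ⊥x₀

    -- Source of n + k + 1 + k ≤ N. Each block joins through a dual family orthogonal to everything
    -- before it: `R` through `T`, x₀ through 2 x₀ (as B x₀ x₀ = 2), and `T` through `R`.
    independent : Independent (((X ++ R) ++ (x₀ ∷ [])) ++ T)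
    independent =
      independent-++
        (independent-++
          (independent-++ (Dual⇒Independent dual) R-dual (⊥ᵥ-swap T⊥X))
          x₀-dual
          (VAll.++⁺ (VAll.map (λ x∈Z → cong (_∷ []) (trans (B-·ʳ 𝟚 _ x₀) (cong (𝟚 ⊗_) (⊥x₀ x∈Z)))) X∈Z)
                    (VAll.map (λ r∈ → cong (_∷ []) (trans (B-·ʳ 𝟚 _ x₀) (cong (𝟚 ⊗_) (⊥radical (proj₁ r∈) x₀∈Perp)))) R∈Radical)))
        (Dual-sym R-dual)
        (VAll.++⁺ (VAll.++⁺ (VAll.map (λ x∈Z → ⊥R (Z⊆PerpPerp x∈Z)) X∈Z) (VAll.map (⊥R ∘ proj₁) R∈Radical))
                  (⊥⇒⊥ᵥ (VAll.map (λ r∈ → trans (B-sym x₀ _) (⊥radical (proj₁ r∈) x₀∈Perp)) R∈Radical) ∷ []))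
      where
      ⊥R : ∀ {u} → PerpPerp u → u ⊥ᵥ R
      ⊥R u∈ = ⊥⇒⊥ᵥ (VAll.map (⊥radical u∈ ∘ proj₂) R∈Radical)

    coding : Coding N (length Z)
    coding = record
      { n = n ; k = k
      ; size≤ = Independent⇒≤ independent
      ; G = G₀
      ; G∈triangles = gram∈triangles X∈Z
      ; nonsingular = G₀-nonsingular
      ; bound = λ φ {L} φ∈L φ-injective → begin
          length Z
            ≤⟨ injectiveOn⇒length≤ (λ z → φ ⟪ z , Y ⟫ , ⟪ z , T ⟫) {L = cartesianProduct L (vectors k)} Z-unique
                 (λ z∈Z w∈Z e → coordinates-injective z∈Z w∈Z
                    (φ-injective (admissible z∈Z) (admissible w∈Z) (compatible z∈Z w∈Z) (cong proj₁ e))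
                    (cong proj₂ e))
                 (λ {z} z∈Z → ∈-cartesianProduct⁺ (φ∈L (admissible z∈Z)) (∈-vectors ⟪ z , T ⟫)) ⟩
          length (cartesianProduct L (vectors k))
            ≡⟨ length-cartesianProductWith _,_ L (vectors k) ⟩
          length L * length (vectors k)
            ≡⟨ cong (length L *_) (length-vectors k) ⟩
          length L * 3 ^ k ∎ }
      where open ℕ.≤-Reasoning

-- Bounds on codings, with the finite checks for dimension 6.

apply-zero : ∀ {n} (G : UpperTriangle n) → apply G 0ᵥ ≡ 0ᵥ
apply-zero [] = refl
apply-zero (r ∷ G) = cong₂ _∷_ (∙-zeroˡ r)
  (trans (cong₂ _+ᵥ_ (·ᵥ-zeroˡ r) (apply-zero G)) (+ᵥ-identityˡ 0ᵥ))

_≟ᵗ_ : ∀ {n} (G H : UpperTriangle n) → Dec (G ≡ H)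
[]      ≟ᵗ []      = yes refl
(r ∷ G) ≟ᵗ (s ∷ H) = map′ (λ (e , f) → cong₂ _∷_ e f) (λ { refl → refl , refl }) ((r ≟ᵥ s) ×-dec (G ≟ᵗ H))

admissible? : ∀ {n} (G : UpperTriangle n) c → Dec (Admissible G c)
admissible? G c = (form G c ≟ 𝟘) ×-dec VAll.all? (λ a → ¬? (a ≟ 𝟙)) (apply G c)

admissibles : ∀ {n} → UpperTriangle n → List (Vecₙ n)
admissibles {n} G = filter (admissible? G) (vectors n)

Degenerate : ∀ {n} → UpperTriangle n → Set
Degenerate G = ∃ λ c → apply G c ≡ 0ᵥ × c ≢ 0ᵥ

degenerate? : ∀ {n} (G : UpperTriangle n) → Dec (Degenerate G)
degenerate? G = anyVector? λ c → (apply G c ≟ᵥ 0ᵥ) ×-dec ¬? (c ≟ᵥ 0ᵥ)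

complete : ∀ n → UpperTriangle n
complete zero    = []
complete (suc n) = replicate n 𝟚 ∷ complete n

-- With one radical coordinate this gives 6 · 3 = 18. Counting all 2³ product vectors would give 24,
-- which is too many.
triangles₃ : All (λ G → Degenerate G ⊎ length (admissibles G) ≤ 6) (triangles 3)
triangles₃ = by-cases (All.all? (λ G → degenerate? G ⊎-dec (_ ℕ.≤? 6)) (triangles 3))

triangles₅ : All (λ G → Degenerate G ⊎ (length (admissibles G) ≤ 19 ⊎ G ≡ complete 5)) (triangles 5)
triangles₅ = by-cases (All.all? (λ G → degenerate? G ⊎-dec ((_ ℕ.≤? 19) ⊎-dec (G ≟ᵗ complete 5))) (triangles 5))

-- If all products are 2, there are 21 admissible codes.  Codes whose entries are 0 and 2,
-- with three 2s, are incompatible if their supports meet in one point; merging two such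
-- pairs leaves 19 codes.
merge : Vecₙ 5 → Vecₙ 5
merge (𝟚 ∷ 𝟘 ∷ 𝟘 ∷ 𝟚 ∷ 𝟚 ∷ []) = 𝟚 ∷ 𝟚 ∷ 𝟚 ∷ 𝟘 ∷ 𝟘 ∷ []
merge (𝟚 ∷ 𝟚 ∷ 𝟘 ∷ 𝟘 ∷ 𝟚 ∷ []) = 𝟘 ∷ 𝟚 ∷ 𝟚 ∷ 𝟚 ∷ 𝟘 ∷ []
merge c                         = c

mergedAdmissibles : List (Vecₙ 5)
mergedAdmissibles = filter (λ c → merge c ≟ᵥ c) (admissibles (complete 5))

mergedAdmissibles≤19 : length mergedAdmissibles * 1 ≤ 19
mergedAdmissibles≤19 = by-cases (_ ℕ.≤? 19)

merge-injective : All (λ c → All (λ d → Compatible (complete 5) c d → merge c ≡ merge d → c ≡ d)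
                    (admissibles (complete 5))) (admissibles (complete 5))
merge-injective = by-cases (All.all? (λ c → All.all? (λ d →
  ¬? (_ ≟ _) →-dec ((merge c ≟ᵥ merge d) →-dec (c ≟ᵥ d))) (admissibles (complete 5))) (admissibles (complete 5)))

merge∈ : All (λ c → merge c ∈ mergedAdmissibles) (admissibles (complete 5))
merge∈ = by-cases (All.all? (λ c → Any.any? (merge c ≟ᵥ_) mergedAdmissibles) (admissibles (complete 5)))

∈-admissibles : ∀ {n} {G : UpperTriangle n} {c} → Admissible G c → c ∈ admissibles G
∈-admissibles {G = G} {c} = ∈-filter⁺ (admissible? G) (∈-vectors c)

module _ {N len} (C : Coding N len) where

  open Coding C

  length≤2^n*3^k : len ≤ 2 ^ n * 3 ^ k
  length≤2^n*3^k = subst (λ l → len ≤ l * 3 ^ k) (length-zeroTwos n)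
    (bound (apply G) (λ a → ∈-zeroTwos (proj₂ a)) (λ _ _ _ → nonsingular))

  length≤admissibles*3^k : len ≤ length (admissibles G) * 3 ^ k
  length≤admissibles*3^k = bound id ∈-admissibles (λ _ _ _ e → e)

  ¬degenerate : ¬ Degenerate G
  ¬degenerate (c , e , c≢0) = c≢0 (nonsingular (trans e (sym (apply-zero G))))

  -- Estimating 3^k by 4^k turns the bound into a power of 2 with exponent n + 2k; the doubling
  -- supplies the remaining 1 in `size≤`.
  2*length≤2^N : 2 * len ≤ 2 ^ N
  2*length≤2^N = begin
    2 * len                     ≤⟨ ℕ.*-monoʳ-≤ 2 length≤2^n*3^k ⟩
    2 * (2 ^ n * 3 ^ k)         ≤⟨ ℕ.*-monoʳ-≤ 2 (ℕ.*-monoʳ-≤ (2 ^ n) (ℕ.^-monoˡ-≤ k (ℕ.n≤1+n 3))) ⟩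
    2 * (2 ^ n * 4 ^ k)         ≡⟨ cong (λ e → 2 * (2 ^ n * e)) (ℕ.^-*-assoc 2 2 k) ⟩
    2 * (2 ^ n * 2 ^ (2 * k))   ≡⟨ cong (2 *_) (ℕ.^-distribˡ-+-* 2 n (2 * k)) ⟨
    2 ^ (1 + (n + 2 * k))       ≤⟨ ℕ.^-monoʳ-≤ 2 (ℕ.≤-trans (ℕ.≤-reflexive (1+n+2k n k)) size≤) ⟩
    2 ^ N                       ∎
    where
    open ℕ.≤-Reasoning
    1+n+2k : ∀ n k → 1 + (n + 2 * k) ≡ n + k + 1 + k
    1+n+2k = solve-∀

-- The two exceptional pairs are those with 2³ · 3 = 24 and 2⁵ = 32.
sizes≤6 : ∀ {n} → n < 6 → ∀ {k} → k < 6 → n + k + 1 + k ≤ 6 →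
          2 ^ n * 3 ^ k ≤ 19 ⊎ ((n ≡ 3 × k ≡ 1) ⊎ (n ≡ 5 × k ≡ 0))
sizes≤6 = by-cases (ℕ.allUpTo? (λ n → ℕ.allUpTo? (λ k → (n + k + 1 + k ℕ.≤? 6) →-dec
  ((2 ^ n * 3 ^ k ℕ.≤? 19) ⊎-dec (((n ℕ.≟ 3) ×-dec (k ℕ.≟ 1)) ⊎-dec ((n ℕ.≟ 5) ×-dec (k ℕ.≟ 0))))) 6) 6)

size-3-1 : ∀ {len} (C : Coding 6 len) → Coding.n C ≡ 3 → Coding.k C ≡ 1 → len ≤ 19
size-3-1 {len} C@(record { G = G ; G∈triangles = G∈ }) refl refl = conclude (All.lookup triangles₃ G∈)
  where
  conclude : Degenerate G ⊎ length (admissibles G) ≤ 6 → len ≤ 19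
  conclude (inj₁ degenerate) = contradiction degenerate (¬degenerate C)
  conclude (inj₂ few) = ℕ.≤-trans (length≤admissibles*3^k C) (ℕ.≤-trans (ℕ.*-monoˡ-≤ 3 few) (ℕ.n≤1+n 18))

size-5-0 : ∀ {len} (C : Coding 6 len) → Coding.n C ≡ 5 → Coding.k C ≡ 0 → len ≤ 19
size-5-0 {len} C@(record { G = G ; G∈triangles = G∈ ; bound = bound }) refl refl = conclude (All.lookup triangles₅ G∈)
  where
  conclude : Degenerate G ⊎ (length (admissibles G) ≤ 19 ⊎ G ≡ complete 5) → len ≤ 19
  conclude (inj₁ degenerate) = contradiction degenerate (¬degenerate C)
  conclude (inj₂ (inj₁ few)) = ℕ.≤-trans (length≤admissibles*3^k C) (ℕ.*-monoˡ-≤ 1 few)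
  conclude (inj₂ (inj₂ refl)) = ℕ.≤-trans
    (bound merge {mergedAdmissibles} (λ a → All.lookup merge∈ (∈-admissibles a))
      (λ a b → All.lookup (All.lookup merge-injective (∈-admissibles a)) (∈-admissibles b)))
    mergedAdmissibles≤19

length≤19 : ∀ {len} → Coding 6 len → len ≤ 19
length≤19 {len} C@(record { n = n ; k = k ; size≤ = size≤ }) =
  [ ℕ.≤-trans (length≤2^n*3^k C) , [ uncurry (size-3-1 C) , uncurry (size-5-0 C) ]′ ]′
    (sizes≤6 n<6 k<6 size≤)
  where
  n+k<6 : n + k < 6
  n+k<6 = ℕ.≤-trans (ℕ.≤-reflexive (ℕ.+-comm 1 (n + k))) (ℕ.≤-trans (ℕ.m≤m+n (n + k + 1) k) size≤)
  n<6 : n < 6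
  n<6 = ℕ.≤-<-trans (ℕ.m≤m+n n k) n+k<6
  k<6 : k < 6
  k<6 = ℕ.≤-<-trans (ℕ.m≤n+m k n) n+k<6

-- Counting the vectors on which the form is 1.

-- For f ≢ 0ᵥ, solution f a parametrises the d with d ∙ f ≡ a by the entries of d
-- other than the one at the first nonzero position of f; junk for f ≡ 0ᵥ.
solution : ∀ {k} → Vecₙ (suc k) → F₃ → Vecₙ k → Vecₙ (suc k)
solution (p@(suc _) ∷ f) a e       = p ⊗ (a ⊖ e ∙ f) ∷ e
solution (𝟘 ∷ f)         a []      = 0ᵥ
solution (𝟘 ∷ f)         a (b ∷ e) = b ∷ solution f a e

solution-∙ : ∀ {k} (f : Vecₙ (suc k)) a e → f ≢ 0ᵥ → solution f a e ∙ f ≡ a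
solution-∙ (𝟙 ∷ f)  a e       f≢0 = solve 2 (λ a b → (con 𝟙 :* (a :- b)) :* con 𝟙 :+ b := a) refl a (e ∙ f)
solution-∙ (𝟚 ∷ f)  a e       f≢0 = solve 2 (λ a b → (con 𝟚 :* (a :- b)) :* con 𝟚 :+ b := a) refl a (e ∙ f)
solution-∙ (𝟘 ∷ []) a []      f≢0 = contradiction refl f≢0
solution-∙ (𝟘 ∷ f)  a (b ∷ e) f≢0 = cong₂ _⊕_ (⊗-zeroʳ b) (solution-∙ f a e (f≢0 ∘ cong (𝟘 ∷_)))

solution-injective : ∀ {k} (f : Vecₙ (suc k)) a {e e′} → f ≢ 0ᵥ → solution f a e ≡ solution f a e′ → e ≡ e′
solution-injective (suc _ ∷ f) a                 f≢0 eq = Vec.∷-injectiveʳ eq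
solution-injective (𝟘 ∷ [])    a                 f≢0 _  = contradiction refl f≢0
solution-injective (𝟘 ∷ f)     a {_ ∷ _} {_ ∷ _} f≢0 eq =
  cong₂ _∷_ (Vec.∷-injectiveˡ eq) (solution-injective f a (f≢0 ∘ cong (𝟘 ∷_)) (Vec.∷-injectiveʳ eq))

nonzeros : ∀ k → List (Vecₙ k)
nonzeros k = filter (λ f → ¬? (f ≟ᵥ 0ᵥ)) (vectors k)

3^k≤1+nonzeros : ∀ k → 3 ^ k ≤ suc (length (nonzeros k))
3^k≤1+nonzeros k = subst (_≤ suc (length (nonzeros k))) (length-vectors k)
  (injectiveOn⇒length≤ id {L = 0ᵥ ∷ nonzeros k} (vectors-unique k) (λ _ _ e → e) (λ {f} _ → split f))
  where
  split : ∀ f → f ∈ 0ᵥ ∷ nonzeros k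
  split f with f ≟ᵥ 0ᵥ
  ... | yes f≡0 = here f≡0
  ... | no f≢0  = there (∈-filter⁺ (λ f → ¬? (f ≟ᵥ 0ᵥ)) (∈-vectors f) f≢0)

lincomb≡comb : ∀ {N} k c (u : Fin k → Vecₙ N) → lincomb k c u ≡ comb (tabulate c) (tabulate u)
lincomb≡comb zero    c u = refl
lincomb≡comb (suc k) c u = cong ((c zero ·ᵥ u zero) +ᵥ_) (lincomb≡comb k (c ∘ suc) (u ∘ suc))

-- The quadratic form on a plane with basis x, y, where α = q x, β = q y and γ = B x y.
binary : F₃ → F₃ → F₃ → Vecₙ 2 → F₃
binary α β γ (a ∷ b ∷ []) = a ⊗ a ⊗ α ⊕ b ⊗ b ⊗ β ⊕ a ⊗ b ⊗ γ

binaryOnes : F₃ → F₃ → F₃ → List (Vecₙ 2)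
binaryOnes α β γ = filter (λ c → binary α β γ c ≟ 𝟙) (vectors 2)

-- An anisotropic plane over F₃ takes each of the values 1 and 2 on four of its eight nonzero
-- vectors; all coefficients are tried.
anisotropic⇒4≤ones : ∀ α β γ → (∀ c → c ≢ 0ᵥ → binary α β γ c ≢ 𝟘) → 4 ≤ length (binaryOnes α β γ)
anisotropic⇒4≤ones = by-cases (all? λ α → all? λ β → all? λ γ →
  (allVectors? λ c → ¬? (c ≟ᵥ 0ᵥ) →-dec ¬? (binary α β γ c ≟ 𝟘)) →-dec (4 ℕ.≤? length (binaryOnes α β γ)))

-- Coordinates adapted to a totally singular subspace.

module _ {N} (𝕍 : QuadraticSpace N) where

  open Space 𝕍

  TotallySingular : ∀ {k} → Vec (Vecₙ N) k → Set
  TotallySingular X = ∀ c → q (comb c X) ≡ 𝟘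

  TotallySingular⇒⊥ : ∀ {k} {X : Vec (Vecₙ N) k} → TotallySingular X → ∀ c d → B (comb c X) (comb d X) ≡ 𝟘
  TotallySingular⇒⊥ {X = X} sing c d = begin
    𝟘 ⊕ 𝟘 ⊕ B (comb c X) (comb d X)
      ≡⟨ cong₂ (λ a b → a ⊕ b ⊕ B (comb c X) (comb d X)) (sing c) (sing d) ⟨
    q (comb c X) ⊕ q (comb d X) ⊕ B (comb c X) (comb d X) ≡⟨ q-+ (comb c X) _ ⟨
    q (comb c X +ᵥ comb d X)   ≡⟨ cong q (comb-+ c d X) ⟨
    q (comb (c +ᵥ d) X)        ≡⟨ sing (c +ᵥ d) ⟩
    𝟘                          ∎
    where open ≡-Reasoning

  -- R and S span k hyperbolic planes; S itself need not be totally singular.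
  record Hyperbolic (k : ℕ) : Set where
    field
      R S   : Vec (Vecₙ N) k
      dual  : Dual R S
      R-sing : TotallySingular R

    R⊥R : ∀ c → comb c R ⊥ᵥ R
    R⊥R c = ∙-nondegenerate _ _ λ d → begin
      d ∙ ⟪ comb c R , R ⟫      ≡⟨ B-comb (comb c R) d R ⟨
      B (comb c R) (comb d R)   ≡⟨ TotallySingular⇒⊥ R-sing c d ⟩
      𝟘                         ≡⟨ ∙-zeroʳ d ⟨
      d ∙ 0ᵥ                    ∎
      where open ≡-Reasoning

    All-R⊥R : VAll.All (_⊥ᵥ R) R
    All-R⊥R = comb-All R⊥R

    module _ {j} (T : Vec (Vecₙ N) j) (T-indep : Independent T)
             (T⊥R : VAll.All (_⊥ᵥ R) T) (T⊥S : VAll.All (_⊥ᵥ S) T) where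

      basis : Vec (Vecₙ N) ((j + k) + k)
      basis = (T ++ R) ++ S

      basis-independent : Independent basis
      basis-independent = independent-++ 𝕍 (independent-++ 𝕍 T-indep dual T⊥S) (Dual-sym dual) (VAll.++⁺ T⊥R All-R⊥R)

      -- The only surviving cross term is between `R` and `S`, and by duality it is d ∙ f. For fixed
      -- c and nonzero f the value of q is thus affine in d and not constant.
      q-basis : ∀ c d f → q (comb ((c ++ d) ++ f) basis) ≡ (q (comb c T) ⊕ q (comb f S)) ⊕ d ∙ f
      q-basis c d f = begin
        q (comb ((c ++ d) ++ f) basis)
          ≡⟨ cong q (trans (comb-++ (c ++ d) f (T ++ R) S) (cong (_+ᵥ s) (comb-++ c d T R))) ⟩
        q ((t +ᵥ r) +ᵥ s)
          ≡⟨ trans (q-+ (t +ᵥ r) s) (cong₂ (λ a b → a ⊕ q s ⊕ b) (q-+ t r) (B-+ˡ t r s)) ⟩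
        q t ⊕ q r ⊕ B t r ⊕ q s ⊕ (B t s ⊕ B r s)
          ≡⟨ cong₂ (λ a b → q t ⊕ a ⊕ b ⊕ q s ⊕ (B t s ⊕ B r s)) (R-sing d)
               (⊥ᵥ⇒⊥comb (Subspace.comb∈ (⊥ᵥ-subspace R) c T⊥R) d) ⟩
        q t ⊕ 𝟘 ⊕ 𝟘 ⊕ q s ⊕ (B t s ⊕ B r s)
          ≡⟨ cong₂ (λ a b → q t ⊕ 𝟘 ⊕ 𝟘 ⊕ q s ⊕ (a ⊕ b))
               (⊥ᵥ⇒⊥comb (Subspace.comb∈ (⊥ᵥ-subspace S) c T⊥S) f)
               (trans (B-sym r s) (trans (B-comb s d R) (cong (d ∙_) (Dual-sym dual f)))) ⟩
        q t ⊕ 𝟘 ⊕ 𝟘 ⊕ q s ⊕ (d ∙ f)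
          ≡⟨ cong (λ a → a ⊕ q s ⊕ d ∙ f) (trans (⊕-identityʳ _) (⊕-identityʳ (q t))) ⟩
        q t ⊕ q s ⊕ d ∙ f ∎
        where
        open ≡-Reasoning
        t = comb c T
        r = comb d R
        s = comb f S

  module Count {k′ j} (H : Hyperbolic (suc k′)) (T : Vec (Vecₙ N) j)
               (T⊥R : VAll.All (_⊥ᵥ Hyperbolic.R H) T) (T⊥S : VAll.All (_⊥ᵥ Hyperbolic.S H) T)
               (T-indep : Independent T)
               (ones : List (Vecₙ j)) (ones-unique : Unique ones) (ones-q : ∀ {c} → c ∈ ones → q (comb c T) ≡ 𝟙) where

    open Hyperbolic H

    k : ℕ
    k = suc k′

    target : Vecₙ k → Vecₙ j → F₃
    target f c = 𝟙 ⊖ (q (comb c T) ⊕ q (comb f S))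

    -- Codes are coordinates with respect to (T ++ R) ++ S: for every nonzero S-part f, and
    -- every T-part c, the equation q = 1 is linear in the R-part.
    code₁ : Vecₙ k × (Vecₙ j × Vecₙ k′) → Vecₙ ((j + k) + k)
    code₁ (f , c , e) = (c ++ solution f (target f c) e) ++ f

    code₂ : Vecₙ j × Vecₙ k → Vecₙ ((j + k) + k)
    code₂ (c , d) = (c ++ d) ++ 0ᵥ {k}

    params₁ : List (Vecₙ k × (Vecₙ j × Vecₙ k′))
    params₁ = cartesianProduct (nonzeros k) (cartesianProduct (vectors j) (vectors k′))

    params₂ : List (Vecₙ j × Vecₙ k)
    params₂ = cartesianProduct ones (vectors k)

    vertexCodes : List (Vecₙ ((j + k) + k))
    vertexCodes = List.map code₁ params₁ List.++ List.map code₂ params₂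

    unpack₁ : ∀ {f c e} → (f , c , e) ∈ params₁ → f ≢ 0ᵥ
    unpack₁ p∈ = proj₂ (∈-filter⁻ (λ f → ¬? (f ≟ᵥ 0ᵥ)) {xs = vectors k}
      (proj₁ (∈-cartesianProduct⁻ (nonzeros k) (cartesianProduct (vectors j) (vectors k′)) p∈)))

    code₁-injective : ∀ {p r} → p ∈ params₁ → r ∈ params₁ → code₁ p ≡ code₁ r → p ≡ r
    code₁-injective {f , c , e} {f′ , c′ , e′} p∈ _ eq
      with Vec.++-injective (c ++ solution f (target f c) e) (c′ ++ solution f′ (target f′ c′) e′) eq
    ... | eq′ , refl with Vec.++-injective c c′ eq′
    ... | refl , eq″ = cong (λ e → f , c , e) (solution-injective f (target f c) (unpack₁ p∈) eq″)

    code₂-injective : ∀ {p r} → p ∈ params₂ → r ∈ params₂ → code₂ p ≡ code₂ r → p ≡ r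
    code₂-injective {c , d} {c′ , d′} _ _ eq
      with Vec.++-injective c c′ (proj₁ (Vec.++-injective (c ++ d) (c′ ++ d′) eq))
    ... | refl , refl = refl

    vertexCodes-unique : Unique vertexCodes
    vertexCodes-unique = Unique.++⁺
      (map-unique code₁ (Unique.cartesianProduct⁺ (Unique.filter⁺ _ (vectors-unique k))
        (Unique.cartesianProduct⁺ (vectors-unique j) (vectors-unique k′))) code₁-injective)
      (map-unique code₂ (Unique.cartesianProduct⁺ ones-unique (vectors-unique k)) code₂-injective)
      λ (x∈₁ , x∈₂) → disjoint x∈₁ x∈₂
      where
      disjoint : ∀ {x} → x ∈ List.map code₁ params₁ → x ∈ List.map code₂ params₂ → ⊥
      disjoint x∈₁ x∈₂ with ∈-map⁻ code₁ x∈₁ | ∈-map⁻ code₂ x∈₂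
      ... | (f , c , e) , p∈ , refl | (c′ , d) , _ , eq =
        unpack₁ p∈ (proj₂ (Vec.++-injective (c ++ solution f (target f c) e) (c′ ++ d) eq))

    vertexCodes-q : ∀ {x} → x ∈ vertexCodes → q (comb x (basis T T-indep T⊥R T⊥S)) ≡ 𝟙
    vertexCodes-q x∈ with ∈-++⁻ (List.map code₁ params₁) x∈
    ... | inj₁ x∈₁ with ∈-map⁻ code₁ x∈₁
    ...   | (f , c , e) , p∈ , refl = begin
      q (comb (code₁ (f , c , e)) (basis T T-indep T⊥R T⊥S))
        ≡⟨ q-basis T T-indep T⊥R T⊥S c (solution f (target f c) e) f ⟩
      q (comb c T) ⊕ q (comb f S) ⊕ solution f (target f c) e ∙ f
        ≡⟨ cong (q (comb c T) ⊕ q (comb f S) ⊕_) (solution-∙ f (target f c) e (unpack₁ p∈)) ⟩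
      q (comb c T) ⊕ q (comb f S) ⊕ target f c
        ≡⟨ solve 1 (λ a → a :+ (con 𝟙 :- a) := con 𝟙) refl (q (comb c T) ⊕ q (comb f S)) ⟩
      𝟙 ∎
      where open ≡-Reasoning
    vertexCodes-q x∈ | inj₂ x∈₂ with ∈-map⁻ code₂ x∈₂
    ... | (c , d) , p∈ , refl = begin
      q (comb (code₂ (c , d)) (basis T T-indep T⊥R T⊥S))
        ≡⟨ q-basis T T-indep T⊥R T⊥S c d 0ᵥ ⟩
      q (comb c T) ⊕ q (comb 0ᵥ S) ⊕ d ∙ 0ᵥ
        ≡⟨ cong₂ (λ a b → a ⊕ b ⊕ d ∙ 0ᵥ) (ones-q (proj₁ (∈-cartesianProduct⁻ ones (vectors k) p∈)))
             (trans (cong q (comb-zero S)) q-0) ⟩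
      𝟙 ⊕ d ∙ 0ᵥ
        ≡⟨ cong (𝟙 ⊕_) (∙-zeroʳ d) ⟩
      𝟙 ∎
      where open ≡-Reasoning

    length-vertexCodes : length vertexCodes ≡ length (nonzeros k) * (3 ^ j * 3 ^ k′) + length ones * 3 ^ k
    length-vertexCodes = begin
      length vertexCodes
        ≡⟨ length-++ (List.map code₁ params₁) ⟩
      length (List.map code₁ params₁) + length (List.map code₂ params₂)
        ≡⟨ cong₂ _+_ (length-map code₁ params₁) (length-map code₂ params₂) ⟩
      length params₁ + length params₂
        ≡⟨ cong₂ _+_
             (trans (length-cartesianProductWith _,_ (nonzeros k) _) (cong (length (nonzeros k) *_)
               (trans (length-cartesianProductWith _,_ (vectors j) (vectors k′))
                 (cong₂ _*_ (length-vectors j) (length-vectors k′)))))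
             (trans (length-cartesianProductWith _,_ ones (vectors k)) (cong (length ones *_) (length-vectors k))) ⟩
      length (nonzeros k) * (3 ^ j * 3 ^ k′) + length ones * 3 ^ k ∎
      where open ≡-Reasoning

    vertices : List (Vecₙ N)
    vertices = List.map (λ x → comb x (basis T T-indep T⊥R T⊥S)) vertexCodes

    vertices-unique : Unique vertices
    vertices-unique = map-unique (λ x → comb x (basis T T-indep T⊥R T⊥S)) vertexCodes-unique
      λ _ _ → Independent⇒injective (basis-independent T T-indep T⊥R T⊥S)

    vertices-q : ∀ {v} → v ∈ vertices → q v ≡ 𝟙
    vertices-q v∈ with ∈-map⁻ (λ x → comb x (basis T T-indep T⊥R T⊥S)) v∈
    ... | x , x∈ , refl = vertexCodes-q x∈

    length-vertices : length vertices ≡ length (nonzeros k) * (3 ^ j * 3 ^ k′) + length ones * 3 ^ k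
    length-vertices = trans (length-map (λ x → comb x (basis T T-indep T⊥R T⊥S)) vertexCodes) length-vertexCodes

  HasTotallySingular : ℕ → Set
  HasTotallySingular k = Σ (Vec (Vecₙ N) k) λ X → Independent X × TotallySingular X

  Hyperbolic⇒HasTotallySingular : ∀ {k} → Hyperbolic k → HasTotallySingular k
  Hyperbolic⇒HasTotallySingular H = R , Dual⇒Independent 𝕍 dual , R-sing
    where open Hyperbolic H

  Hyperbolic⇒≤ : ∀ {k} → Hyperbolic k → k + k ≤ N
  Hyperbolic⇒≤ H = Independent⇒≤ (independent-++ 𝕍 (Dual⇒Independent 𝕍 dual) (Dual-sym dual) All-R⊥R)
    where open Hyperbolic H

  -- A saturated system between the span of `W` and the whole space: by nondegeneracy its `X` spans
  -- all of `W`, so it has at least k members. Equality is recovered later from the dimension or the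
  -- type.
  totallySingular-extends : ∀ {k} → HasTotallySingular k → ∃ λ k₀ → k ≤ k₀ × Hyperbolic k₀
  totallySingular-extends {k} (W , W-indep , W-sing) = size , k≤size , record
    { R = X ; S = Y ; dual = dual ; R-sing = λ c → span-singular (Subspace.comb∈ Span-subspace c X∈A) }
    where
    Span : Vecₙ N → Set
    Span v = ∃ λ c → comb c W ≡ v
    Span-subspace : Subspace Span
    Span-subspace = record
      { 0∈ = 0ᵥ , comb-zero W
      ; +∈ = λ { (c , refl) (d , refl) → c +ᵥ d , comb-+ c d W }
      ; ·∈ = λ { a (c , refl) → a ·ᵥ c , comb-· a c W } }
    span-singular : ∀ {v} → Span v → q v ≡ 𝟘
    span-singular (c , refl) = W-sing c
    Span? : ∀ v → Dec (Span v)
    Span? v = anyVector? λ c → comb c W ≟ᵥ v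
    everything : Subspace (λ (_ : Vecₙ N) → ⊤)
    everything = record { 0∈ = tt ; +∈ = λ _ _ → tt ; ·∈ = λ _ _ → tt }
    system : ∃ (Saturated Span? (λ _ → yes tt) everything)
    system = saturated-system Span? (λ _ → yes tt) everything
    open DualSystem (proj₁ system)
    reconstruct : ∀ c → comb c W ≡ comb ⟪ comb c W , Y ⟫ X
    reconstruct c = x-y≡0⇒x≡y _ _ (nondegenerate _ λ t → proj₂ system (c , refl) tt)
    k≤size : k ≤ size
    k≤size = injective⇒dim≤ (λ c → ⟪ comb c W , Y ⟫) λ {c} {d} e → Independent⇒injective W-indep
      (trans (reconstruct c) (trans (cong (λ x → comb x X) e) (sym (reconstruct d))))

  module Complement {k} (H : Hyperbolic k) where

    open Hyperbolic H

    InComplement : Vecₙ N → Set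
    InComplement v = v ⊥ᵥ R × v ⊥ᵥ S

    inComplement? : ∀ v → Dec (InComplement v)
    inComplement? v = (⟪ v , R ⟫ ≟ᵥ 0ᵥ) ×-dec (⟪ v , S ⟫ ≟ᵥ 0ᵥ)

    complement-subspace : Subspace InComplement
    complement-subspace = record
      { 0∈ = Subspace.0∈ (⊥ᵥ-subspace R) , Subspace.0∈ (⊥ᵥ-subspace S)
      ; +∈ = λ (p , p′) (r , r′) → Subspace.+∈ (⊥ᵥ-subspace R) p r , Subspace.+∈ (⊥ᵥ-subspace S) p′ r′
      ; ·∈ = λ c (p , p′) → Subspace.·∈ (⊥ᵥ-subspace R) c p , Subspace.·∈ (⊥ᵥ-subspace S) c p′ }

    -- The order matters: the inner step makes the vector orthogonal to `R`, and the outer one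
    -- subtracts a combination of `R`, harmless because `R` is orthogonal to itself. `S` need not
    -- be.
    projection : Vecₙ N → Vecₙ N
    projection w = residual R S (residual S R w)

    projection∈ : ∀ w → InComplement (projection w)
    projection∈ w =
      Subspace.-∈ (⊥ᵥ-subspace R) (residual-⊥ (Dual-sym dual) w) (R⊥R ⟪ residual S R w , S ⟫) ,
      residual-⊥ dual (residual S R w)

    B-projection : ∀ {v} → InComplement v → ∀ w → B v (projection w) ≡ B v w
    B-projection {v} (v⊥R , v⊥S) w = begin
      B v (projection w)                     ≡⟨ residual-adjoint S R v (residual S R w) ⟨
      B (residual S R v) (residual S R w)    ≡⟨ cong (λ u → B u (residual S R w)) (residual-trivial v⊥R) ⟩
      B v (residual S R w)                   ≡⟨ residual-adjoint R S v w ⟨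
      B (residual R S v) w                   ≡⟨ cong (λ u → B u w) (residual-trivial v⊥S) ⟩
      B v w                                  ∎
      where open ≡-Reasoning

    system : ∃ (Saturated inComplement? inComplement? complement-subspace)
    system = saturated-system inComplement? inComplement? complement-subspace

    open DualSystem (proj₁ system) public
      using () renaming (size to j; X to T; Y to T′; X∈A to T∈; dual to T-dual)

    complement-determined : ∀ {v} → InComplement v → v ⊥ᵥ T′ → v ≡ 0ᵥ
    complement-determined {v} v∈ v⊥T′ = nondegenerate v λ w → begin
      B v w                                    ≡⟨ B-projection v∈ w ⟨
      B v (projection w)                       ≡⟨ cong (λ u → B u (projection w)) (residual-trivial v⊥T′) ⟨
      B (residual T T′ v) (projection w)       ≡⟨ proj₂ system v∈ (projection∈ w) ⟩
      𝟘                                        ∎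
      where open ≡-Reasoning

    -- A vector orthogonal to `R` and `S` lies in the complement, and if orthogonal to `T′` as well
    -- it vanishes; so k + k + j products determine a vector.
    dim≤ : N ≤ k + (k + j)
    dim≤ = injective⇒dim≤ (λ v → ⟪ v , R ++ (S ++ T′) ⟫) λ {v} {w} e → x-y≡0⇒x≡y v w (determined (v -ᵥ w)
      (trans (⟪⟫-- v w (R ++ (S ++ T′))) (trans (cong (_-ᵥ ⟪ w , R ++ (S ++ T′) ⟫) e) (-ᵥ-self _))))
      where
      ⟪⟫-++ : ∀ {a b} v (X : Vec (Vecₙ N) a) (Y : Vec (Vecₙ N) b) → v ⊥ᵥ (X ++ Y) → v ⊥ᵥ X × v ⊥ᵥ Y
      ⟪⟫-++ v []      Y e = refl , e
      ⟪⟫-++ v (x ∷ X) Y e = cong₂ _∷_ (Vec.∷-injectiveˡ e) (proj₁ rest) , proj₂ rest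
        where rest = ⟪⟫-++ v X Y (Vec.∷-injectiveʳ e)
      determined : ∀ v → v ⊥ᵥ (R ++ (S ++ T′)) → v ≡ 0ᵥ
      determined v e with ⟪⟫-++ v R (S ++ T′) e
      ... | v⊥R , e′ with ⟪⟫-++ v S T′ e′
      ... | v⊥S , v⊥T′ = complement-determined (v⊥R , v⊥S) v⊥T′

  module _ {k} (H : Hyperbolic k) where

    open Hyperbolic H
    open Complement H

    -- A nonzero singular vector of the complement could be adjoined to `R`.
    anisotropic : ¬ HasTotallySingular (suc k) → ∀ {t} → InComplement t → t ≢ 0ᵥ → q t ≢ 𝟘
    anisotropic ¬ts {t} (t⊥R , t⊥S) t≢0 qt≡0 = ¬ts ((t ∷ []) ++ R , independent-++ 𝕍 t-indep dual (t⊥S ∷ []) , sing)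
      where
      t-indep : Independent (t ∷ [])
      t-indep (a ∷ []) e = cong (_∷ []) (decidable-stable (a ≟ 𝟘) λ a≢0 → t≢0 (begin
        t                   ≡⟨ ·ᵥ-identityˡ t ⟨
        𝟙 ·ᵥ t              ≡⟨ cong (_·ᵥ t) (≢0⇒square≡1 a a≢0) ⟨
        (a ⊗ a) ·ᵥ t        ≡⟨ ·ᵥ-assoc a a t ⟩
        a ·ᵥ (a ·ᵥ t)       ≡⟨ cong (a ·ᵥ_) (trans (sym (+ᵥ-identityʳ (a ·ᵥ t))) e) ⟩
        a ·ᵥ 0ᵥ             ≡⟨ ·ᵥ-zeroʳ a ⟩
        0ᵥ                  ∎))
        where open ≡-Reasoning
      sing : TotallySingular ((t ∷ []) ++ R)
      sing (a ∷ c) = begin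
        q ((a ·ᵥ t) +ᵥ comb c R)                            ≡⟨ q-+ (a ·ᵥ t) (comb c R) ⟩
        q (a ·ᵥ t) ⊕ q (comb c R) ⊕ B (a ·ᵥ t) (comb c R)   ≡⟨ cong₂ _⊕_ (cong₂ _⊕_ (q-· a t) (R-sing c)) (B-·ˡ a t _) ⟩
        a ⊗ a ⊗ q t ⊕ 𝟘 ⊕ a ⊗ B t (comb c R)                ≡⟨ cong₂ (λ x y → a ⊗ a ⊗ x ⊕ 𝟘 ⊕ a ⊗ y) qt≡0 (⊥ᵥ⇒⊥comb t⊥R c) ⟩
        a ⊗ a ⊗ 𝟘 ⊕ 𝟘 ⊕ a ⊗ 𝟘                               ≡⟨ cong₂ (λ x y → x ⊕ 𝟘 ⊕ y) (⊗-zeroʳ (a ⊗ a)) (⊗-zeroʳ a) ⟩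
        𝟘                                                   ∎
        where open ≡-Reasoning

    q-binary : ∀ x y c → q (comb c (x ∷ y ∷ [])) ≡ binary (q x) (q y) (B x y) c
    q-binary x y (a ∷ b ∷ []) = begin
      q ((a ·ᵥ x) +ᵥ ((b ·ᵥ y) +ᵥ 0ᵥ))                  ≡⟨ cong (λ v → q ((a ·ᵥ x) +ᵥ v)) (+ᵥ-identityʳ (b ·ᵥ y)) ⟩
      q ((a ·ᵥ x) +ᵥ (b ·ᵥ y))                          ≡⟨ q-+ (a ·ᵥ x) (b ·ᵥ y) ⟩
      q (a ·ᵥ x) ⊕ q (b ·ᵥ y) ⊕ B (a ·ᵥ x) (b ·ᵥ y)
        ≡⟨ cong₂ _⊕_ (cong₂ _⊕_ (q-· a x) (q-· b y)) (trans (B-·ˡ a x _) (trans (cong (a ⊗_) (B-·ʳ b x y)) (sym (⊗-assoc a b _)))) ⟩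
      a ⊗ a ⊗ q x ⊕ b ⊗ b ⊗ q y ⊕ a ⊗ b ⊗ B x y         ∎
      where open ≡-Reasoning

    complementPlane : 2 ≤ j → Σ (Vecₙ N) λ x → Σ (Vecₙ N) λ y →
                      InComplement x × InComplement y × Independent (x ∷ y ∷ [])
    complementPlane 2≤j = firstTwo 2≤j T∈ (Dual⇒Independent 𝕍 T-dual)
      where
      heads≡0 : ∀ {a b l} → _≡_ {A = Vecₙ (suc (suc l))} (a ∷ b ∷ 0ᵥ) 0ᵥ → a ∷ b ∷ [] ≡ 0ᵥ
      heads≡0 refl = refl
      firstTwo : ∀ {l} {X : Vec (Vecₙ N) l} → 2 ≤ l → VAll.All InComplement X → Independent X →
                 Σ (Vecₙ N) λ x → Σ (Vecₙ N) λ y → InComplement x × InComplement y × Independent (x ∷ y ∷ [])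
      firstTwo {X = x ∷ y ∷ X} (s≤s (s≤s z≤n)) (x∈ ∷ y∈ ∷ _) indep =
        x , y , x∈ , y∈ , λ { (a ∷ b ∷ []) e → heads≡0 (indep (a ∷ b ∷ 0ᵥ)
          (trans (cong (λ v → (a ·ᵥ x) +ᵥ ((b ·ᵥ y) +ᵥ v)) (comb-zero X)) e)) }

  record VertexVectors (size : ℕ) : Set where
    field
      members        : List (Vecₙ N)
      members-unique : Unique members
      members-q      : ∀ {v} → v ∈ members → q v ≡ 𝟙
      size≤length    : size ≤ length members

  -- The count with an empty `T`: the S-part must be nonzero. For `suc k′` = m the total is (3^m -
  -- 1) · 3^(m-1).
  hyperbolic-vertices : ∀ {k′} → Hyperbolic (suc k′) → VertexVectors (length (nonzeros (suc k′)) * 3 ^ k′)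
  hyperbolic-vertices {k′} H = record
    { members = vertices ; members-unique = vertices-unique ; members-q = vertices-q
    ; size≤length = begin
        length (nonzeros k) * 3 ^ k′              ≡⟨ cong (length (nonzeros k) *_) (ℕ.*-identityˡ (3 ^ k′)) ⟨
        length (nonzeros k) * (1 * 3 ^ k′)        ≡⟨ ℕ.+-identityʳ _ ⟨
        length (nonzeros k) * (1 * 3 ^ k′) + 0    ≡⟨ length-vertices ⟨
        length vertices                           ∎ }
    where
    open ℕ.≤-Reasoning
    []-independent : Independent {N} []
    []-independent [] _ = refl
    no-ones : ∀ {c} → c ∈ [] → q (comb c []) ≡ 𝟙
    no-ones ()
    open Count H [] [] [] []-independent [] [] no-ones

  -- For a lower bound one plane in the anisotropic complement suffices: 9 choices of its part when
  -- the S-part is nonzero, at least 4 otherwise. With `suc k′` = m - 1 this adds up to (3^m + 1) ·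
  -- 3^(m-1).
  elliptic-vertices : ∀ {k′} → Hyperbolic (suc k′) → 2 + (suc k′ + suc k′) ≤ N → ¬ HasTotallySingular (2 + k′) →
                      VertexVectors (length (nonzeros (suc k′)) * (9 * 3 ^ k′) + 4 * 3 ^ suc k′)
  elliptic-vertices {k′} H 2+k+k≤N ¬ts with complementPlane H 2≤j
    where
    2≤j : 2 ≤ Complement.j H
    2≤j = ℕ.+-cancelʳ-≤ (suc k′ + suc k′) 2 _ (ℕ.≤-trans 2+k+k≤N (ℕ.≤-trans (Complement.dim≤ H)
      (ℕ.≤-reflexive (trans (sym (ℕ.+-assoc (suc k′) (suc k′) _)) (ℕ.+-comm (suc k′ + suc k′) _)))))
  ... | x , y , x∈ , y∈ , xy-indep = record
    { members = vertices ; members-unique = vertices-unique ; members-q = vertices-q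
    ; size≤length = begin
        length (nonzeros k) * (9 * 3 ^ k′) + 4 * 3 ^ k
          ≤⟨ ℕ.+-monoʳ-≤ (length (nonzeros k) * (9 * 3 ^ k′)) (ℕ.*-monoˡ-≤ (3 ^ k) 4≤ones) ⟩
        length (nonzeros k) * (9 * 3 ^ k′) + length ones * 3 ^ k
          ≡⟨ length-vertices ⟨
        length vertices ∎ }
    where
    open ℕ.≤-Reasoning
    open Complement H
    ones : List (Vecₙ 2)
    ones = binaryOnes (q x) (q y) (B x y)
    4≤ones : 4 ≤ length ones
    4≤ones = anisotropic⇒4≤ones (q x) (q y) (B x y) λ c c≢0 e →
      anisotropic H ¬ts (Subspace.comb∈ complement-subspace c (x∈ ∷ y∈ ∷ []))
        (c≢0 ∘ xy-indep c) (trans (q-binary H x y c) e)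
    one? : ∀ c → Dec (binary (q x) (q y) (B x y) c ≡ 𝟙)
    one? c = binary (q x) (q y) (B x y) c ≟ 𝟙
    ones-unique : Unique ones
    ones-unique = Unique.filter⁺ one? (vectors-unique 2)
    ones-q : ∀ {c} → c ∈ ones → q (comb c (x ∷ y ∷ [])) ≡ 𝟙
    ones-q {c} c∈ = trans (q-binary H x y c) (proj₂ (∈-filter⁻ one? {xs = vectors 2} c∈))
    T⊥R : VAll.All (_⊥ᵥ Hyperbolic.R H) (x ∷ y ∷ [])
    T⊥R = proj₁ x∈ ∷ proj₁ y∈ ∷ []
    T⊥S : VAll.All (_⊥ᵥ Hyperbolic.S H) (x ∷ y ∷ [])
    T⊥S = proj₂ x∈ ∷ proj₂ y∈ ∷ []
    open Count H (x ∷ y ∷ []) T⊥R T⊥S xy-indep ones ones-unique ones-q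

-- Representatives and longest lists in a finite universe.

module _ {a r} {A : Set a} {R : A → A → Set r} where

  AllPairs-lookup : ∀ {xs x y} → AllPairs R xs → x ∈ xs → y ∈ xs → x ≡ y ⊎ (R x y ⊎ R y x)
  AllPairs-lookup (_ ∷ _)   (here refl) (here refl) = inj₁ refl
  AllPairs-lookup (rx ∷ _)  (here refl) (there y∈)  = inj₂ (inj₁ (All.lookup rx y∈))
  AllPairs-lookup (ry ∷ _)  (there x∈)  (here refl) = inj₂ (inj₂ (All.lookup ry x∈))
  AllPairs-lookup (_ ∷ rxs) (there x∈)  (there y∈)  = AllPairs-lookup rxs x∈ y∈

  module _ (R? : ∀ x y → Dec (R x y)) where

    representatives : (∀ {x} → R x x) → (∀ {x y} → R x y → R y x) → ∀ xs →
                      ∃ λ ys → AllPairs (λ x y → ¬ R x y) ys × (∀ {x} → x ∈ xs → Any (λ y → R y x) ys)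
    representatives R-refl R-sym [] = [] , [] , λ ()
    representatives R-refl R-sym (x ∷ xs) with representatives R-refl R-sym xs
    ... | ys , distinct , covers with Any.any? (λ y → R? y x) ys
    ... | yes covered = ys , distinct , λ { (here refl) → covered ; (there x∈) → covers x∈ }
    ... | no ¬covered = x ∷ ys , All.map (λ ¬Ryx Rxy → ¬Ryx (R-sym Rxy)) (All.¬Any⇒All¬ ys ¬covered) ∷ distinct ,
      λ { (here refl) → here R-refl ; (there x∈) → there (covers x∈) }

    module _ (universe : List A) (∈-universe : ∀ x → x ∈ universe) where

      listsOfLength : ℕ → List (List A)
      listsOfLength zero    = [] ∷ []
      listsOfLength (suc n) = cartesianProductWith _∷_ universe (listsOfLength n)

      ∈-listsOfLength : ∀ xs → xs ∈ listsOfLength (length xs)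
      ∈-listsOfLength []       = here refl
      ∈-listsOfLength (x ∷ xs) = ∈-cartesianProductWith⁺ _∷_ (∈-universe x) (∈-listsOfLength xs)

      listOfLength? : ∀ n → Dec (∃ λ xs → AllPairs R xs × length xs ≡ n)
      listOfLength? n = map′ Any.satisfied (λ { (xs , p , refl) → lose (∈-listsOfLength xs) (p , refl) })
        (Any.any? (λ xs → AllPairs.allPairs? R? xs ×-dec (length xs ℕ.≟ n)) (listsOfLength n))

      -- Lists of a given length over a finite universe can be searched, so descending from the
      -- bound b stops at the maximum. This supplies the clique and coclique numbers.
      longest : ∀ b → (∀ xs → AllPairs R xs → length xs ≤ b) →
                ∃ λ n → (∃ λ xs → AllPairs R xs × length xs ≡ n) × (∀ xs → AllPairs R xs → length xs ≤ n)
      longest zero    ≤b = zero , ([] , [] , refl) , ≤b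
      longest (suc b) ≤b with listOfLength? (suc b)
      ... | yes xs = suc b , xs , ≤b
      ... | no ¬xs = longest b λ xs p → ℕ.≤-pred (ℕ.≤∧≢⇒< (≤b xs p) λ e → ¬xs (xs , p , e))

-- Families indexed by `Fin k` versus vectors of vectors.

HasTotSingSub⇒HasTotallySingular : ∀ {N k} (Q : QuadForm N) (nd : Nondegenerate Q) →
  HasTotSingSub Q k → HasTotallySingular (quadraticSpace Q nd) k
HasTotSingSub⇒HasTotallySingular {k = k} Q nd (u , indep , sing) =
  tabulate u ,
  (λ c e → lookups≡0 c (indep (lookup c) (trans (lincomb-lookup c) e))) ,
  (λ c → trans (cong (eval Q) (sym (lincomb-lookup c))) (sing (lookup c)))
  where
  lincomb-lookup : ∀ c → lincomb k (lookup c) u ≡ comb c (tabulate u)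
  lincomb-lookup c = trans (lincomb≡comb k (lookup c) u) (cong (λ d → comb d (tabulate u)) (Vec.tabulate∘lookup c))
  lookups≡0 : ∀ {n} (c : Vecₙ n) → (∀ i → lookup c i ≡ 𝟘) → c ≡ 0ᵥ
  lookups≡0 []      _ = refl
  lookups≡0 (a ∷ c) e = cong₂ _∷_ (e zero) (lookups≡0 c (e ∘ suc))

HasTotallySingular⇒HasTotSingSub : ∀ {N k} (Q : QuadForm N) (nd : Nondegenerate Q) →
  HasTotallySingular (quadraticSpace Q nd) k → HasTotSingSub Q k
HasTotallySingular⇒HasTotSingSub {k = k} Q nd (X , indep , sing) =
  lookup X ,
  (λ c e i → trans (sym (Vec.lookup∘tabulate c i))
    (trans (cong (λ d → lookup d i) (indep (tabulate c) (trans (sym (lincomb-lookup c)) e))) (Vec.lookup-replicate i 𝟘))) ,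
  (λ c → trans (cong (eval Q) (lincomb-lookup c)) (sing (tabulate c)))
  where
  lincomb-lookup : ∀ c → lincomb k c (lookup X) ≡ comb (tabulate c) X
  lincomb-lookup c = trans (lincomb≡comb k c (lookup X)) (cong (comb (tabulate c)) (Vec.tabulate∘lookup X))

-- Lines as an equivalence on vectors.

sameLine-refl : ∀ {N} {x : Vecₙ N} → SameLine x x
sameLine-refl {x = x} = 𝟙 , (λ ()) , sym (·ᵥ-identityˡ x)

·ᵥ-square : ∀ {N} {c} (x : Vecₙ N) → c ≢ 𝟘 → c ·ᵥ (c ·ᵥ x) ≡ x
·ᵥ-square {c = c} x c≢0 =
  trans (sym (·ᵥ-assoc c c x)) (trans (cong (_·ᵥ x) (≢0⇒square≡1 c c≢0)) (·ᵥ-identityˡ x))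

sameLine-sym : ∀ {N} {x y : Vecₙ N} → SameLine x y → SameLine y x
sameLine-sym {x = x} (c , c≢0 , refl) = c , c≢0 , sym (·ᵥ-square x c≢0)

sameLine? : ∀ {N} (x y : Vecₙ N) → Dec (SameLine x y)
sameLine? x y = any? λ c → ¬? (c ≟ 𝟘) ×-dec (y ≟ᵥ (c ·ᵥ x))

-- Cliques, and the normalisation of cocliques.

module _ {N} (𝕍 : QuadraticSpace N) where

  open Space 𝕍

  Orthogonal NonOrthogonal : Vecₙ N → Vecₙ N → Set
  Orthogonal x y = B x y ≡ 𝟘
  NonOrthogonal x y = ¬ SameLine x y × B x y ≢ 𝟘

  orthogonal⇒independent : ∀ {xs} → All (λ x → q x ≡ 𝟙) xs → AllPairs Orthogonal xs → Independent (fromList xs)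
  orthogonal⇒independent [] [] [] _ = refl
  orthogonal⇒independent {x ∷ xs} (qx≡1 ∷ q≡1) (x⊥xs ∷ orth) (a ∷ c) e =
    cong₂ _∷_ a≡0 (orthogonal⇒independent q≡1 orth c (begin
      comb c (fromList xs)                   ≡⟨ +ᵥ-identityˡ _ ⟨
      0ᵥ +ᵥ comb c (fromList xs)             ≡⟨ cong (_+ᵥ comb c (fromList xs)) (trans (cong (_·ᵥ x) a≡0) (·ᵥ-zeroˡ x)) ⟨
      (a ·ᵥ x) +ᵥ comb c (fromList xs)       ≡⟨ e ⟩
      0ᵥ                                     ∎))
    where
    open ≡-Reasoning
    x⊥ : ∀ {ys} → All (Orthogonal x) ys → x ⊥ᵥ fromList ys
    x⊥ [] = refl
    x⊥ (p ∷ ps) = cong₂ _∷_ p (x⊥ ps)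
    double≡0 : ∀ a → a ⊗ 𝟚 ⊕ 𝟘 ≡ 𝟘 → a ≡ 𝟘
    double≡0 = by-cases (all? λ a → (_ ≟ _) →-dec (_ ≟ _))
    a≡0 : a ≡ 𝟘
    a≡0 = double≡0 a (begin
      a ⊗ 𝟚 ⊕ 𝟘
        ≡⟨ cong₂ _⊕_ (trans (B-·ʳ a x x) (cong (a ⊗_) (trans (B-self x) (cong neg qx≡1)))) (⊥ᵥ⇒⊥comb (x⊥ x⊥xs) c) ⟨
      B x (a ·ᵥ x) ⊕ B x (comb c (fromList xs))       ≡⟨ B-+ʳ x _ _ ⟨
      B x ((a ·ᵥ x) +ᵥ comb c (fromList xs))          ≡⟨ cong (B x) e ⟩
      B x 0ᵥ                                          ≡⟨ B-0ʳ x ⟩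
      𝟘                                               ∎)

  module _ {x₀ : Vecₙ N} {xs : List (Vecₙ N)} (q≡1 : All (λ x → q x ≡ 𝟙) (x₀ ∷ xs))
           (coclique : AllPairs NonOrthogonal (x₀ ∷ xs)) where

    D : List (Vecₙ N)
    D = x₀ ∷ xs

    B≢0 : ∀ {x y} → x ∈ D → y ∈ D → B x y ≢ 𝟘
    B≢0 {x} x∈ y∈ with AllPairs-lookup coclique x∈ y∈
    ... | inj₁ refl = λ e → case (trans (sym e) (trans (B-self x) (cong neg (All.lookup q≡1 x∈))))
      where
      case : 𝟘 ≢ 𝟚
      case ()
    ... | inj₂ (inj₁ (_ , B≢0)) = B≢0
    ... | inj₂ (inj₂ (_ , B≢0)) = λ e → B≢0 (trans (B-sym _ _) e)

    sameLine⇒≡ : ∀ {x y} → x ∈ D → y ∈ D → SameLine x y → x ≡ y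
    sameLine⇒≡ x∈ y∈ same with AllPairs-lookup coclique x∈ y∈
    ... | inj₁ x≡y = x≡y
    ... | inj₂ (inj₁ (¬same , _)) = contradiction same ¬same
    ... | inj₂ (inj₂ (¬same , _)) = contradiction (sameLine-sym same) ¬same

    -- For b ≢ 𝟘 one has neg b ⊗ b = 𝟚, so this scalar brings the product with x₀ to 𝟚, the value of
    -- B x₀ x₀.
    sign : Vecₙ N → F₃
    sign y = neg (B y x₀)

    shift : Vecₙ N → Vecₙ N
    shift y = (sign y ·ᵥ y) -ᵥ x₀

    sign≢0 : ∀ {y} → y ∈ D → sign y ≢ 𝟘
    sign≢0 {y} y∈ e = B≢0 y∈ (here refl) (neg≡0⇒≡0 (B y x₀) e)

    B-signed : ∀ {y} → y ∈ D → B (sign y ·ᵥ y) x₀ ≡ 𝟚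
    B-signed {y} y∈ = trans (B-·ˡ (sign y) y x₀) (neg-square (B y x₀) (B≢0 y∈ (here refl)))
      where
      neg-square : ∀ a → a ≢ 𝟘 → neg a ⊗ a ≡ 𝟚
      neg-square = by-cases (all? λ a → ¬? (_ ≟ _) →-dec (_ ≟ _))

    qx₀≡1 : q x₀ ≡ 𝟙
    qx₀≡1 = All.lookup q≡1 (here refl)

    Bx₀x₀≡2 : B x₀ x₀ ≡ 𝟚
    Bx₀x₀≡2 = trans (B-self x₀) (cong neg qx₀≡1)

    -- The three terms of q are 1, 1 and 2 · 2, with sum 6 = 0.
    shift-singular : ∀ {y} → y ∈ D → q (shift y) ≡ 𝟘
    shift-singular {y} y∈ = begin
      q (shift y)
        ≡⟨ q-+ (sign y ·ᵥ y) (𝟚 ·ᵥ x₀) ⟩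
      q (sign y ·ᵥ y) ⊕ q (𝟚 ·ᵥ x₀) ⊕ B (sign y ·ᵥ y) (𝟚 ·ᵥ x₀)
        ≡⟨ cong₂ _⊕_ (cong₂ _⊕_
             (trans (q-· (sign y) y) (cong₂ _⊗_ (≢0⇒square≡1 (sign y) (sign≢0 y∈)) (All.lookup q≡1 y∈)))
             (trans (q-· 𝟚 x₀) qx₀≡1))
             (trans (B-·ʳ 𝟚 (sign y ·ᵥ y) x₀) (cong (𝟚 ⊗_) (B-signed y∈))) ⟩
      𝟘 ∎
      where open ≡-Reasoning

    shift⊥x₀ : ∀ {y} → y ∈ D → B (shift y) x₀ ≡ 𝟘
    shift⊥x₀ {y} y∈ = trans (B--ˡ (sign y ·ᵥ y) x₀ x₀) (cong₂ _⊖_ (B-signed y∈) Bx₀x₀≡2)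

    -- As `shift z` is orthogonal to x₀, the product is that of the signed vectors minus 2. It would
    -- be 1 only if y and z were orthogonal.
    B-shift : ∀ {y z} → y ∈ D → z ∈ D → B (shift y) (shift z) ≢ 𝟙
    B-shift {y} {z} y∈ z∈ e = nonzero (sign y) (sign z) (B y z) (sign≢0 y∈) (sign≢0 z∈) (B≢0 y∈ z∈) (begin
      sign y ⊗ (sign z ⊗ B y z) ⊖ 𝟚
        ≡⟨ cong₂ _⊖_ (trans (cong (sign y ⊗_) (sym (B-·ʳ (sign z) y z))) (sym (B-·ˡ (sign y) y _))) (sym (B-signed y∈)) ⟩
      B (sign y ·ᵥ y) (sign z ·ᵥ z) ⊖ B (sign y ·ᵥ y) x₀
        ≡⟨ B--ʳ (sign y ·ᵥ y) (sign z ·ᵥ z) x₀ ⟨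
      B (sign y ·ᵥ y) (shift z)
        ≡⟨ ⊕-identityʳ _ ⟨
      B (sign y ·ᵥ y) (shift z) ⊖ 𝟘
        ≡⟨ cong (B (sign y ·ᵥ y) (shift z) ⊖_) (trans (B-sym x₀ (shift z)) (shift⊥x₀ z∈)) ⟨
      B (sign y ·ᵥ y) (shift z) ⊖ B x₀ (shift z)
        ≡⟨ B--ˡ (sign y ·ᵥ y) x₀ (shift z) ⟨
      B (shift y) (shift z)
        ≡⟨ e ⟩
      𝟙 ∎)
      where
      open ≡-Reasoning
      nonzero : ∀ a b c → a ≢ 𝟘 → b ≢ 𝟘 → c ≢ 𝟘 → a ⊗ (b ⊗ c) ⊖ 𝟚 ≢ 𝟙
      nonzero = by-cases (all? λ a → all? λ b → all? λ c →
        ¬? (_ ≟ _) →-dec (¬? (_ ≟ _) →-dec (¬? (_ ≟ _) →-dec ¬? (_ ≟ _))))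

    shift-injective : ∀ {y z} → y ∈ D → z ∈ D → shift y ≡ shift z → y ≡ z
    shift-injective {y} {z} y∈ z∈ e = sameLine⇒≡ y∈ z∈
      (sign z ⊗ sign y , product≢0 (sign z) (sign y) (sign≢0 z∈) (sign≢0 y∈) , (begin
        z                            ≡⟨ ·ᵥ-square z (sign≢0 z∈) ⟨
        sign z ·ᵥ (sign z ·ᵥ z)      ≡⟨ cong (sign z ·ᵥ_) signed≡ ⟨
        sign z ·ᵥ (sign y ·ᵥ y)      ≡⟨ ·ᵥ-assoc (sign z) (sign y) y ⟨
        (sign z ⊗ sign y) ·ᵥ y       ∎))
      where
      open ≡-Reasoning
      product≢0 : ∀ a b → a ≢ 𝟘 → b ≢ 𝟘 → a ⊗ b ≢ 𝟘
      product≢0 = by-cases (all? λ a → all? λ b → ¬? (_ ≟ _) →-dec (¬? (_ ≟ _) →-dec ¬? (_ ≟ _)))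
      signed≡ : sign y ·ᵥ y ≡ sign z ·ᵥ z
      signed≡ = +ᵥ-cancelˡ (𝟚 ·ᵥ x₀) (trans (+ᵥ-comm _ (sign y ·ᵥ y)) (trans e (+ᵥ-comm (sign z ·ᵥ z) _)))

    D-unique : Unique D
    D-unique = AllPairs.map (λ { (¬same , _) refl → ¬same sameLine-refl }) coclique

    from-shift : ∀ {P : Vecₙ N → Set} → (∀ {y} → y ∈ D → P (shift y)) → ∀ {z} → z ∈ List.map shift D → P z
    from-shift p z∈ with ∈-map⁻ shift z∈
    ... | y , y∈ , refl = p y∈

    coclique⇒coding : Coding N (length D)
    coclique⇒coding = subst (Coding N) (length-map shift D)
      (coding 𝕍 x₀ qx₀≡1 (List.map shift D) (map-unique shift D-unique shift-injective)
        (from-shift shift-singular) (from-shift shift⊥x₀)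
        (λ z∈ w∈ → from-shift {λ z → ∀ {w} → w ∈ List.map shift D → B z w ≢ 𝟙}
          (λ y∈ → from-shift (B-shift y∈)) z∈ w∈))

  -- Lower bounds for the order of the graph.

  members≤2*order : ∀ {size} → VertexVectors 𝕍 size → (reps : List (Vecₙ N)) →
                    (∀ {v} → q v ≡ 𝟙 → Any (λ u → SameLine u v) reps) → size ≤ 2 * length reps
  members≤2*order {size} L reps covers = begin
    size                                      ≤⟨ size≤length ⟩
    length members                            ≤⟨ injectiveOn⇒length≤ id {L = reps List.++ List.map (𝟚 ·ᵥ_) reps}
                                                   members-unique (λ _ _ e → e) (λ v∈ → represented (covers (members-q v∈))) ⟩
    length (reps List.++ List.map (𝟚 ·ᵥ_) reps) ≡⟨ trans (length-++ reps) (cong (length reps +_) (length-map (𝟚 ·ᵥ_) reps)) ⟩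
    length reps + length reps                 ≡⟨ cong (length reps +_) (ℕ.+-identityʳ (length reps)) ⟨
    2 * length reps                           ∎
    where
    open VertexVectors L
    open ℕ.≤-Reasoning
    represented : ∀ {v} → Any (λ u → SameLine u v) reps → v ∈ reps List.++ List.map (𝟚 ·ᵥ_) reps
    represented line with find line
    ... | u , u∈ , (𝟘 , c≢0 , _)    = contradiction refl c≢0
    ... | u , u∈ , (𝟙 , _   , refl) = ∈-++⁺ˡ (subst (_∈ reps) (sym (·ᵥ-identityˡ u)) u∈)
    ... | u , u∈ , (𝟚 , _   , refl) = ∈-++⁺ʳ reps (∈-map⁺ (𝟚 ·ᵥ_) u∈)

double≤ : ∀ {a b} → a + a ≤ 2 * b → a ≤ b
double≤ {a} {b} a+a≤2b = ℕ.*-cancelˡ-≤ 2 (subst (_≤ 2 * b) (cong (a +_) (sym (ℕ.+-identityʳ a))) a+a≤2b)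

-- size + 3^m′ is the form of the vertex count whose lower estimate does not depend on the type.
ManyVertices : ∀ m′ {N} → QuadraticSpace N → Set
ManyVertices m′ 𝕍 = ∃ λ size → VertexVectors 𝕍 size × 3 ^ suc m′ * 3 ^ m′ ≤ size + 3 ^ m′

module _ {N} (𝕍 : QuadraticSpace N) where

  -- The extended system cannot exceed m, since 2k ≤ N = 2m.
  hyperbolic-many : ∀ m′ → N ≡ 2 * suc m′ → HasTotallySingular 𝕍 (suc m′) → ManyVertices m′ 𝕍
  hyperbolic-many m′ N≡2m ts = conclude (totallySingular-extends 𝕍 ts)
    where
    open ℕ.≤-Reasoning
    m = suc m′
    estimate : Hyperbolic 𝕍 m → ManyVertices m′ 𝕍
    estimate H = _ , hyperbolic-vertices 𝕍 H , (begin
      3 ^ m * 3 ^ m′                           ≤⟨ ℕ.*-monoˡ-≤ (3 ^ m′) (3^k≤1+nonzeros m) ⟩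
      3 ^ m′ + length (nonzeros m) * 3 ^ m′    ≡⟨ ℕ.+-comm (3 ^ m′) _ ⟩
      length (nonzeros m) * 3 ^ m′ + 3 ^ m′    ∎)
    conclude : (∃ λ k → m ≤ k × Hyperbolic 𝕍 k) → ManyVertices m′ 𝕍
    conclude (k , m≤k , H) = estimate (subst (Hyperbolic 𝕍) (ℕ.≤-antisym k≤m m≤k) H)
      where
      k≤m : k ≤ m
      k≤m = double≤ (subst (k + k ≤_) N≡2m (Hyperbolic⇒≤ 𝕍 H))

  -- The extended system has size m - 1 or m by dimension, and m is excluded by the type.
  elliptic-many : ∀ k′ → N ≡ 2 * (2 + k′) → HasTotallySingular 𝕍 (suc k′) → ¬ HasTotallySingular 𝕍 (2 + k′) →
                  ManyVertices (suc k′) 𝕍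
  elliptic-many k′ N≡2m ts ¬ts = conclude (totallySingular-extends 𝕍 ts)
    where
    open ℕ.≤-Reasoning
    l = suc k′
    P = 3 ^ l
    z = length (nonzeros l)
    dimension : ∀ k → 2 + (k + k) ≡ 2 * suc k
    dimension = solve-∀
    regroup : ∀ z p → 3 * suc z * (3 * p) + 2 * (3 * p) ≡ z * (9 * p) + 4 * (3 * p) + 3 * p
    regroup = solve-∀
    estimate : Hyperbolic 𝕍 l → ManyVertices l 𝕍
    estimate H = _ , elliptic-vertices 𝕍 H (ℕ.≤-reflexive (trans (dimension l) (sym N≡2m))) ¬ts , (begin
      3 * 3 ^ l * P                   ≤⟨ ℕ.*-monoˡ-≤ P (ℕ.*-monoʳ-≤ 3 (3^k≤1+nonzeros l)) ⟩
      3 * suc z * P                   ≤⟨ ℕ.m≤m+n _ (2 * P) ⟩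
      3 * suc z * P + 2 * P           ≡⟨ regroup z (3 ^ k′) ⟩
      z * (9 * 3 ^ k′) + 4 * P + P    ∎)
    conclude : (∃ λ k → l ≤ k × Hyperbolic 𝕍 k) → ManyVertices l 𝕍
    conclude (k , l≤k , H) = estimate (subst (Hyperbolic 𝕍) (ℕ.≤-antisym (ℕ.≤-pred (ℕ.≤∧≢⇒< k≤m k≢m)) l≤k) H)
      where
      k≤m : k ≤ suc l
      k≤m = double≤ (subst (k + k ≤_) N≡2m (Hyperbolic⇒≤ 𝕍 H))
      k≢m : k ≢ suc l
      k≢m refl = ¬ts (Hyperbolic⇒HasTotallySingular 𝕍 H)

manyVertices : ∀ k′ ε (Q : QuadForm (2 * (2 + k′))) (nd : Nondegenerate Q) → HasType (2 + k′) ε Q →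
               ManyVertices (suc k′) (quadraticSpace Q nd)
manyVertices k′ Sign.+ Q nd ts =
  hyperbolic-many (quadraticSpace Q nd) (suc k′) refl (HasTotSingSub⇒HasTotallySingular Q nd ts)
manyVertices k′ Sign.- Q nd (ts , ¬ts) =
  elliptic-many (quadraticSpace Q nd) k′ refl (HasTotSingSub⇒HasTotallySingular Q nd ts)
    (¬ts ∘ HasTotallySingular⇒HasTotSingSub Q nd)

-- Numerical comparison for m ≥ 4.

-- At m = 4 this reads 2075 < 2187; at m = 3 it would fail, with 393 against 243. From m to m + 1
-- the right side grows by the factor 9 and the left side by at most 9, as 8 (m + 1) ≤ 18 m.
4^m-bound : ∀ n → 2 * (4 + n) * 2 ^ (2 * (4 + n)) + 3 ^ (3 + n) < 3 ^ (4 + n) * 3 ^ (3 + n)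
4^m-bound zero    = by-cases (_ ℕ.<? _)
4^m-bound (suc n) = begin-strict
  2 * (5 + n) * 2 ^ (2 * (5 + n)) + 3 ^ (4 + n)
    ≡⟨ cong (λ e → 2 * (5 + n) * e + 3 ^ (4 + n)) (trans (cong (2 ^_) (shift-exponent n)) (ℕ.^-distribˡ-+-* 2 2 (2 * (4 + n)))) ⟩
  2 * (5 + n) * (4 * A) + 3 * 3 ^ (3 + n)
    ≤⟨ ℕ.+-mono-≤ (grow n A) (ℕ.*-monoˡ-≤ (3 ^ (3 + n)) (ℕ.m≤m+n 3 6)) ⟩
  9 * (2 * (4 + n) * A) + 9 * 3 ^ (3 + n)
    ≡⟨ ℕ.*-distribˡ-+ 9 (2 * (4 + n) * A) _ ⟨
  9 * (2 * (4 + n) * A + 3 ^ (3 + n))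
    <⟨ ℕ.*-monoʳ-< 9 (4^m-bound n) ⟩
  9 * (3 ^ (4 + n) * 3 ^ (3 + n))
    ≡⟨ nine (3 ^ (4 + n)) (3 ^ (3 + n)) ⟩
  3 ^ (5 + n) * 3 ^ (4 + n) ∎
  where
  open ℕ.≤-Reasoning
  A = 2 ^ (2 * (4 + n))
  shift-exponent : ∀ n → 2 * (5 + n) ≡ 2 + 2 * (4 + n)
  shift-exponent = solve-∀
  nine : ∀ a b → 9 * (a * b) ≡ 3 * a * (3 * b)
  nine = solve-∀
  split : ∀ n A → 9 * (2 * (4 + n) * A) ≡ 2 * (5 + n) * (4 * A) + (32 + 10 * n) * A
  split = solve-∀
  grow : ∀ n A → 2 * (5 + n) * (4 * A) ≤ 9 * (2 * (4 + n) * A)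
  grow n A = subst (2 * (5 + n) * (4 * A) ≤_) (sym (split n A)) (ℕ.m≤m+n _ _)

toList-∈ : ∀ {a p} {A : Set a} {P : A → Set p} {xs} (pxs : All P xs) {x} → x ∈ xs → ∃ λ px → (x , px) ∈ All.toList pxs
toList-∈ (px ∷ _)   (here refl) = px , here refl
toList-∈ (_ ∷ pxs) (there x∈) with toList-∈ pxs x∈
... | px , ∈pxs = px , there ∈pxs

-- Transfer to the graph, and the conclusion.

module _ {N} (Q : QuadForm N) (nd : Nondegenerate Q) where

  open Graph (NO Q) using () renaming (V to Vertex)

  𝕍 : QuadraticSpace N
  𝕍 = quadraticSpace Q nd

  isVertex? : ∀ x → Dec (eval Q x ≡ 𝟙)
  isVertex? x = eval Q x ≟ 𝟙

  vertexList : List Vertex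
  vertexList = All.toList (All.all-filter isVertex? (vectors N))

  ∈-vertexList : ∀ v → v ∈ vertexList
  ∈-vertexList (x , p) with toList-∈ (All.all-filter isVertex? (vectors N)) (∈-filter⁺ isVertex? (∈-vectors x) p)
  -- A vertex carries its proof of Q x = 1, so the listed proof has to be identified with the given
  -- one.
  ... | p′ , x∈ = subst (λ p → (x , p) ∈ vertexList) (uip p′ p) x∈

  clique-length : ∀ vs → IsClique (NO Q) vs → length vs ≤ N
  clique-length vs clique = subst (_≤ N) (length-map proj₁ vs) (Independent⇒≤
    (orthogonal⇒independent 𝕍 (All.map⁺ (All.universal proj₂ vs)) (AllPairs.map⁺ (AllPairs.map proj₂ clique))))

  coclique-coding : ∀ v vs → IsCoclique (NO Q) (v ∷ vs) → Coding N (suc (length vs))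
  coclique-coding v vs coclique = subst (Coding N ∘ suc) (length-map proj₁ vs)
    (coclique⇒coding 𝕍 (All.map⁺ (All.universal proj₂ (v ∷ vs))) (AllPairs.map⁺ coclique))

  coclique-length : ∀ vs → IsCoclique (NO Q) vs → 2 * length vs ≤ 2 ^ N
  coclique-length []       _        = z≤n
  coclique-length (v ∷ vs) coclique = 2*length≤2^N (coclique-coding v vs coclique)

  cliqueNumber : ∃ (CliqueNumber (NO Q))
  cliqueNumber = longest (λ u v → ¬? (sameLine? (proj₁ u) (proj₁ v)) ×-dec (polar Q (proj₁ u) (proj₁ v) ≟ 𝟘))
    vertexList ∈-vertexList N clique-length

  cocliqueNumber : ∃ (CocliqueNumber (NO Q))
  cocliqueNumber = longest (λ u v → ¬? (sameLine? (proj₁ u) (proj₁ v)) ×-dec ¬? (polar Q (proj₁ u) (proj₁ v) ≟ 𝟘))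
    vertexList ∈-vertexList (2 ^ N) λ vs coclique → ℕ.≤-trans (ℕ.m≤m+n _ _) (coclique-length vs coclique)

  order : ∀ {size} → VertexVectors 𝕍 size → ∃ λ n → HasOrder (NO Q) n × size ≤ 2 * n
  order L with representatives (λ (u v : Vertex) → sameLine? (proj₁ u) (proj₁ v)) sameLine-refl sameLine-sym vertexList
  ... | reps , distinct , covers =
    length reps , (reps , refl , distinct , λ v → covers (∈-vertexList v)) ,
    subst (λ n → _ ≤ 2 * n) (length-map proj₁ reps)
      (members≤2*order 𝕍 L (List.map proj₁ reps) λ {v} qv≡1 → Any.map⁺ (covers (∈-vertexList (v , qv≡1))))

-- The factor 2 accounts for the two vectors on each line, and the summand 3^(m-1) is the correction
-- in `ManyVertices`, to be cancelled at the end.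
product-bound : ∀ n (Q : QuadForm (2 * (3 + n))) (nd : Nondegenerate Q) {w a} →
                CliqueNumber (NO Q) w → CocliqueNumber (NO Q) a →
                2 * (w * a) + 3 ^ (2 + n) < 3 ^ (3 + n) * 3 ^ (2 + n)
product-bound zero Q nd ((C , C-clique , refl) , _) ((D , D-coclique , refl) , _) = begin-strict
  2 * (length C * length D) + 9
    ≤⟨ ℕ.+-monoˡ-≤ 9 (ℕ.*-monoʳ-≤ 2 (ℕ.*-mono-≤ (clique-length Q nd C C-clique) (≤19 D D-coclique))) ⟩
  237
    <⟨ by-cases (237 ℕ.<? 243) ⟩
  243 ∎
  where
  open ℕ.≤-Reasoning
  ≤19 : ∀ D → IsCoclique (NO Q) D → length D ≤ 19
  ≤19 []      _        = z≤n
  ≤19 (v ∷ D) coclique = length≤19 (coclique-coding Q nd v D coclique)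
product-bound (suc n) Q nd ((C , C-clique , refl) , _) ((D , D-coclique , refl) , _) = begin-strict
  2 * (length C * length D) + 3 ^ (3 + n)
    ≡⟨ cong (_+ 3 ^ (3 + n)) (swap (length C) (length D)) ⟩
  length C * (2 * length D) + 3 ^ (3 + n)
    ≤⟨ ℕ.+-monoˡ-≤ (3 ^ (3 + n)) (ℕ.*-mono-≤ (clique-length Q nd C C-clique) (coclique-length Q nd D D-coclique)) ⟩
  2 * (4 + n) * 2 ^ (2 * (4 + n)) + 3 ^ (3 + n)
    <⟨ 4^m-bound n ⟩
  3 ^ (4 + n) * 3 ^ (3 + n) ∎
  where
  open ℕ.≤-Reasoning
  swap : ∀ c d → 2 * (c * d) ≡ c * (2 * d)
  swap = solve-∀

theorem3p2 : (m : ℕ) → 3 ≤ m → (ε : Sign) → (Q : QuadForm (2 * m))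
    → Nondegenerate Q → HasType m ε Q → Separating (NO Q)
theorem3p2 (suc (suc (suc n))) (s≤s (s≤s (s≤s z≤n))) ε Q nd type =
  let w , isW = cliqueNumber Q nd
      a , isA = cocliqueNumber Q nd
      size , L , size-large = manyVertices (1 + n) ε Q nd type
      v , isOrder , size≤2v = order Q nd L
      2wa<size = ℕ.+-cancelʳ-< (3 ^ (2 + n)) (2 * (w * a)) size (ℕ.<-≤-trans (product-bound n Q nd isW isA) size-large)
  in v , w , a , isOrder , isW , isA , ℕ.*-cancelˡ-< 2 (w * a) v (ℕ.<-≤-trans 2wa<size size≤2v)
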